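{- Let $(\lambda/\mu,r)$ be an r-shape, $n\ge\lambda_1$, and $\mathbf a,\mathbf b\in\mathbb Z^n$ column flags for it. Then $$\mathsf S^{\mathbf a,\mathbf b}_{\lambda/\mu}(\mathbf y/\mathbf z)=\sum_{T\in ST_{\lambda/\mu}(\mathbf a,\mathbf b)}wt(T).$$
   Context: Skew diagram $\lambda/\mu=\{(i,j):\mu_i<j\le\lambda_i\}$ in English notation, conjugates $\lambda',\mu'$. An r-shape $(\lambda/\mu,r)$ has content function $c(i,j)=j-i+r-1+\lambda'_1$. $e_n(\mathbf x/\mathbf y)=\sum_{i=0}^n(-1)^{n-i}e_i(\mathbf x)h_{n-i}(\mathbf y)$ ($0$ for $n<0$); for $\mathbf y=(y_i)_{i\in\mathbb Z}$, $\mathbf y_{a,b}=(y_a,\dots,y_b)$ if $a\le b$ and empty otherwise. Column flags: $\mathbf a,\mathbf b\in\mathbb Z^n$ with $a_i-a_{i+1}\le\mu'_i-\mu'_{i+1}+1$ and $b_i-b_{i+1}\le\lambda'_i-\lambda'_{i+1}+1$ whenever $\mu'_i<\lambda'_{i+1}$; conjugate flags $a'_i=a_i+c(\mu'_i+1,i)$, $b'_i=b_i+c(\lambda'_i,i)$. $\mathsf S^{\mathbf a,\mathbf b}_{\lambda/\mu}(\mathbf y/\mathbf z)=\det[e_{\lambda'_i-i-\mu'_j+j}(\mathbf y_{a_j,b_i}/\mathbf z_{a'_j,b'_i})]_{1\le i,j\le n}$. A flagged $\mathbb Z$-SSYT of the r-shape with flags $\mathbf a,\mathbf b$ is a filling $\tilde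 T=(\tilde T_{i,j})$ of the cells by integers, weakly increasing along rows (left to right), strictly increasing down columns, with $a_j\le\tilde T_{i,j}\le b_j$ for every cell in column $j$. From such $\tilde T$ a flagged super tableau $T$ is produced by choosing, independently for each cell $(i,j)$, either $T_{i,j}=\tilde T_{i,j}\in\mathbb Z$ or the primed entry $T_{i,j}=(\tilde T_{i,j}+c(i,j))'\in\mathbb Z'=\{k':k\in\mathbb Z\}$. $ST_{\lambda/\mu}(\mathbf a,\mathbf b)$ is the set of all super tableaux so produced from all flagged $\mathbb Z$-SSYT. Weights: $wt(T_{i,j})=y_k$ if $T_{i,j}=k$, $wt(T_{i,j})=-z_k$ if $T_{i,j}=k'$; $wt(T)=\prod_{(i,j)}wt(T_{i,j})$. -}

module Defs where

open import Level using (Level)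
open import Algebra.Bundles using (CommutativeRing)
open import Data.Nat as ℕ using (ℕ; zero; suc; _∸_)
open import Data.Integer as ℤ using (ℤ; +_; -[1+_])
open import Data.Fin using (Fin; zero; suc; toℕ; punchIn)
open import Data.List using (List; []; _∷_; map; upTo; length; filter; foldr; concat)
open import Data.Product using (_×_; Σ-syntax)
open import Data.Sum using (_⊎_)
open import Relation.Binary.PropositionalEquality using (_≡_)

-- Partitions, stored as lists of parts (trailing zeros allowed).
-- All indices below are 1-based as in the paper.

-- part p i = p_i  (0 when i = 0 or i > length p)
part : List ℕ → ℕ → ℕ
part []       _             = 0
part (x ∷ xs) zero          = 0
part (x ∷ xs) (suc zero)    = x
part (x ∷ xs) (suc (suc k)) = part xs (suc k)

IsPartition : List ℕ → Set
IsPartition p = ∀ i → part p (suc (suc i)) ℕ.≤ part p (suc i)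

Contained : List ℕ → List ℕ → Set
Contained mu la = ∀ i → part mu i ℕ.≤ part la i

conj : List ℕ → ℕ → ℕ
conj p j = length (filter (j ℕ.≤?_) p)

InD : List ℕ → List ℕ → ℕ → ℕ → Set
InD mu la i j = (part mu i ℕ.< j) × (j ℕ.≤ part la i)

content : ℤ → List ℕ → ℕ → ℕ → ℤ
content r la i j = + j ℤ.- + i ℤ.+ r ℤ.- + 1 ℤ.+ + conj la 1

-- Fillings of λ/μ : a list of rows; row i (1-based) lists the entries of
-- cells (i, μ_i+1), ..., (i, λ_i) from left to right.

nth : {A : Set} → A → List A → ℕ → A
nth d []       _       = d
nth d (x ∷ xs) zero    = x
nth d (x ∷ xs) (suc k) = nth d xs k

row : {A : Set} → List (List A) → ℕ → List A
row []       _             = []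
row (r ∷ rs) zero          = []
row (r ∷ rs) (suc zero)    = r
row (r ∷ rs) (suc (suc k)) = row rs (suc k)

HasShape : {A : Set} → List ℕ → List ℕ → List (List A) → Set
HasShape mu la T = (length T ≡ length la) × (∀ i → length (row T i) ≡ part la i ∸ part mu i)

-- entry in cell (i,j) (the default d is only returned outside the diagram)
cell : {A : Set} → A → List ℕ → List (List A) → ℕ → ℕ → A
cell d mu T i j = nth d (row T i) (j ∸ suc (part mu i))

cellZ : List ℕ → List (List ℤ) → ℕ → ℕ → ℤ
cellZ = cell (+ 0)

col : {n : ℕ} → Fin n → ℕ
col j = suc (toℕ j)

IsFlaggedZSSYT : List ℕ → List ℕ → (n : ℕ) → (Fin n → ℤ) → (Fin n → ℤ) → List (List ℤ) → Set
IsFlaggedZSSYT mu la n a b T =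
  HasShape mu la T ×
  (∀ i j → InD mu la i j → InD mu la i (suc j) → cellZ mu T i j ℤ.≤ cellZ mu T i (suc j)) ×
  (∀ i j → InD mu la i j → InD mu la (suc i) j → cellZ mu T i j ℤ.< cellZ mu T (suc i) j) ×
  (∀ i (j : Fin n) → InD mu la i (col j) →
     (a j ℤ.≤ cellZ mu T i (col j)) × (cellZ mu T i (col j) ℤ.≤ b j))

ColumnFlags : List ℕ → List ℕ → (n : ℕ) → (Fin n → ℤ) → (Fin n → ℤ) → Set
ColumnFlags mu la n a b =
  ∀ (i k : Fin n) → toℕ k ≡ suc (toℕ i) → conj mu (col i) ℕ.< conj la (col k) →
    (a i ℤ.- a k ℤ.≤ + conj mu (col i) ℤ.- + conj mu (col k) ℤ.+ + 1) ×
    (b i ℤ.- b k ℤ.≤ + conj la (col i) ℤ.- + conj la (col k) ℤ.+ + 1)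

aConj : ℤ → List ℕ → List ℕ → {n : ℕ} → (Fin n → ℤ) → Fin n → ℤ
aConj r mu la a j = a j ℤ.+ content r la (suc (conj mu (col j))) (col j)

bConj : ℤ → List ℕ → {n : ℕ} → (Fin n → ℤ) → Fin n → ℤ
bConj r la b i = b i ℤ.+ content r la (conj la (col i)) (col i)

-- Super entries: unp k = k ∈ ℤ, pr k = k' ∈ ℤ'

data SEntry : Set where
  unp : ℤ → SEntry
  pr  : ℤ → SEntry

cellS : List ℕ → List (List SEntry) → ℕ → ℕ → SEntry
cellS = cell (unp (+ 0))

InST : ℤ → List ℕ → List ℕ → (n : ℕ) → (Fin n → ℤ) → (Fin n → ℤ) → List (List SEntry) → Set
InST r mu la n a b T =
  Σ[ Tt ∈ List (List ℤ) ]
    IsFlaggedZSSYT mu la n a b Tt ×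
    HasShape mu la T ×
    (∀ i j → InD mu la i j →
       (cellS mu T i j ≡ unp (cellZ mu Tt i j)) ⊎
       (cellS mu T i j ≡ pr (cellZ mu Tt i j ℤ.+ content r la i j)))

seg : {a : Level} {A : Set a} → (ℤ → A) → ℤ → ℤ → List A
seg f a b with b ℤ.- a
... | -[1+ _ ] = []
... | + k      = map (λ t → f (a ℤ.+ + t)) (upTo (suc k))

-- Algebra over a commutative ring (polynomial identities are stated for
-- arbitrary commutative rings and arbitrary values of the variables).

module Alg {c ℓ : Level} (R : CommutativeRing c ℓ) where
  open CommutativeRing R using (Carrier; _+_; _*_; -_; 0#; 1#)

  sign : ℕ → Carrier
  sign zero    = 1#
  sign (suc k) = - sign k

  sumFin : {n : ℕ} → (Fin n → Carrier) → Carrier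
  sumFin {zero}  f = 0#
  sumFin {suc n} f = f zero + sumFin (λ i → f (suc i))

  det : (n : ℕ) → (Fin n → Fin n → Carrier) → Carrier
  det zero    M = 1#
  det (suc n) M = sumFin (λ j → sign (toℕ j) * (M zero j * det n (λ i k → M (suc i) (punchIn j k))))

  eSym : ℕ → List Carrier → Carrier
  eSym zero    _        = 1#
  eSym (suc k) []       = 0#
  eSym (suc k) (x ∷ xs) = eSym (suc k) xs + x * eSym k xs

  hSym : ℕ → List Carrier → Carrier
  hSym zero    _        = 1#
  hSym (suc k) []       = 0#
  hSym (suc k) (x ∷ xs) = hSym (suc k) xs + x * hSym k (x ∷ xs)

  sumTo : ℕ → (ℕ → Carrier) → Carrier
  sumTo m f = foldr (λ i acc → f i + acc) 0# (upTo (suc m))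

  eSuper : ℤ → List Carrier → List Carrier → Carrier
  eSuper -[1+ _ ] xs ys = 0#
  eSuper (+ m)    xs ys = sumTo m (λ i → sign (m ∸ i) * (eSym i xs * hSym (m ∸ i) ys))

  Sab : (y z : ℤ → Carrier) → ℤ → List ℕ → List ℕ → (n : ℕ) → (Fin n → ℤ) → (Fin n → ℤ) → Carrier
  Sab y z r mu la n a b = det n (λ i j →
    eSuper (+ conj la (col i) ℤ.- + col i ℤ.- + conj mu (col j) ℤ.+ + col j)
           (seg y (a j) (b i))
           (seg z (aConj r mu la a j) (bConj r la b i)))

  wtE : (y z : ℤ → Carrier) → SEntry → Carrier
  wtE y z (unp k) = y k
  wtE y z (pr k)  = - z k

  wt : (y z : ℤ → Carrier) → List (List SEntry) → Carrier
  wt y z T = foldr (λ e acc → wtE y z e * acc) 1# (concat T)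

  sumWt : (y z : ℤ → Carrier) → List (List (List SEntry)) → Carrier
  sumWt y z L = foldr (λ T acc → wt y z T + acc) 0# L

{-# OPTIONS --safe #-}
module Submission where

-- Fill a flagged tableau value by value. The cells of column j are then the steps of a lattice path: at time t the
-- path stands on the diagonal p = i − j and may step to p + 1, which fills the cell (i , j) with t and has weight
-- y_t − z_{t+c(i,j)}. Since c(i , j) depends on p only, the weight is a function of t and p alone.
-- The super elementary function satisfies
--   e_k(x,𝐱 / z,𝐳) = e_k(𝐱 / 𝐳) + (x − z) e_{k−1}(𝐱 / z,𝐳),
-- the recursion of the generating function of one path, so the theorem is of Lindström–Gessel–Viennot type. The
-- flags, which constrain starting and final times, are turned into a condition Ok on pairs (t , p): steps violating
-- it get weight 0. The column flag inequalities make this harmless within each connected part of the shape, and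
-- entries of the determinant that link different parts do not contribute, by a zero block.
-- No involution on paths is needed. Reading the possible steps in the standardization order (by time, then by
-- column from the left) and expanding the determinant in the column of the next step gives
-- D(m) = D′(m) + w D′(m + e_j), where D′(m + e_j) has two equal columns or a large zero block whenever m + e_j is not
-- a partition inside λ′; tableaux satisfy the same recursion.

-- The main obstacle is that the flags bound values column by column, whereas the cancellation of
-- blocked steps needs weights that forget the column. The difference t - p reconciles the two.
-- Filling a cell raises t and p together and waiting raises t alone, so t - p never decreases along
-- a path: a lower bound at the first cell of a column and an upper bound at its last cell hold at
-- all of its cells. In these terms the flag inequalities say exactly that the bounds `α` and `β`
-- grow weakly from a column to the next one if the two are linked. On the starting diagonal of
-- column j only columns q ≥ j have cells, so a lower bound borrowed from such a column implies that
-- of j; dually for upper bounds at the last cell. Where the shape falls apart the inequalities say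
-- nothing, and there the entries of the two determinants may differ.

open import Defs
open import Level using (Level)
open import Algebra.Bundles using (CommutativeRing)
import Algebra.Properties.CommutativeSemigroup
import Algebra.Properties.Ring
import Algebra.Solver.Ring.NaturalCoefficients.Default
open import Data.Bool as Bool using (Bool; true; false; if_then_else_)
open import Data.Fin using (Fin; zero; suc; toℕ; fromℕ<; punchIn; punchOut)
import Data.Fin.Properties as FinP
open import Data.Integer as ℤ using (ℤ; +_; -[1+_]; +≤+; +<+)
import Data.Integer.Properties as ℤP
open import Data.Integer.Solver using (module +-*-Solver)
open import Data.List using (List; []; _∷_; map; _++_; allFin; applyUpTo; length; foldr)
import Data.List.Properties as ListP
open import Data.List.Membership.Propositional using (_∈_)
open import Data.List.Membership.Propositional.Properties using (∈-allFin; ∈-map⁺; ∈-map⁻; ∈-++⁺ˡ; ∈-++⁺ʳ)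
open import Data.List.Membership.Propositional.Properties.WithK using (unique∧set⇒bag)
open import Data.List.Relation.Binary.BagAndSetEquality using (∼bag⇒↭)
import Data.List.Relation.Binary.Permutation.Propositional as Perm
open import Data.List.Relation.Unary.All as All using (All; []; _∷_)
import Data.List.Relation.Unary.All.Properties as AllP
open import Data.List.Relation.Unary.AllPairs as AllPairs using (AllPairs; []; _∷_)
import Data.List.Relation.Unary.AllPairs.Properties as AllPairsP
open import Data.List.Relation.Unary.Any as Any using (Any; here; there)
import Data.List.Relation.Unary.Any.Properties as AnyP
open import Data.List.Relation.Unary.Unique.Propositional using (Unique)
open import Data.Nat as ℕ using (ℕ; zero; suc; z≤n; s≤s; _∸_; _≤_)
import Data.Nat.Properties as ℕP
open import Data.Product using (_×_; _,_; ∃; Σ-syntax; proj₁; proj₂)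
open import Data.Sum using (_⊎_; inj₁; inj₂)
open import Data.Unit using (⊤; tt)
open import Function using (_∘_; id; mk⇔)
open import Relation.Binary.Definitions using (tri<; tri≈; tri>)
open import Relation.Binary.PropositionalEquality using (_≡_; _≢_)
import Relation.Binary.PropositionalEquality as ≡
import Relation.Binary.Reasoning.Setoid
open import Relation.Nullary using (¬_; Dec; yes; no; contradiction; does)
open import Relation.Nullary.Decidable using (_×-dec_; map′)

open +-*-Solver using () renaming (solve to solveℤ; _:=_ to _⊜_; _:+_ to _⊹_; _:-_ to _⊟_; con to K̂)

-- Determinants

bit : Bool → ℕ
bit b = if b then 1 else 0

count : {n : ℕ} → (Fin n → Bool) → ℕ
count {zero}  C = 0
count {suc n} C = bit (C zero) ℕ.+ count (C ∘ suc)

count-punchIn : ∀ {n} (C : Fin (suc n) → Bool) j → count C ≡ bit (C j) ℕ.+ count (C ∘ punchIn j)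
count-punchIn         C zero    = ≡.refl
count-punchIn {suc n} C (suc j) =
  ≡.trans (≡.cong (bit (C zero) ℕ.+_) (count-punchIn (C ∘ suc) j))
          (x∙yz≈y∙xz (bit (C zero)) (bit (C (suc j))) _)
  where open Algebra.Properties.CommutativeSemigroup ℕP.+-commutativeSemigroup

bit≤1 : ∀ b → bit b ℕ.≤ 1
bit≤1 true  = ℕP.≤-refl
bit≤1 false = z≤n

count-minor : ∀ {n s} (C : Fin (suc n) → Bool) j → suc s ℕ.≤ count C → s ℕ.≤ count (C ∘ punchIn j)
count-minor C j h = ℕP.≤-pred (ℕP.≤-trans h
  (ℕP.≤-trans (ℕP.≤-reflexive (count-punchIn C j)) (ℕP.+-monoˡ-≤ _ (bit≤1 (C j)))))

count-minor-∉ : ∀ {n s} (C : Fin (suc n) → Bool) j → C j ≡ false → s ℕ.≤ count C → s ℕ.≤ count (C ∘ punchIn j)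
count-minor-∉ C j ¬c h =
  ℕP.≤-trans h (ℕP.≤-reflexive (≡.trans (count-punchIn C j) (≡.cong (λ b → bit b ℕ.+ count (C ∘ punchIn j)) ¬c)))

below : (s : ℕ) {n : ℕ} → Fin n → Bool
below s j = toℕ j ℕ.<ᵇ s

below⇒< : ∀ s {n} (j : Fin n) → below s j ≡ true → toℕ j ℕ.< s
below⇒< s j e = ℕP.<ᵇ⇒< (toℕ j) s (≡.subst Bool.T (≡.sym e) tt)

≮⇒below : ∀ s {n} (j : Fin n) → s ℕ.≤ toℕ j → below s j ≡ false
≮⇒below s j h with toℕ j ℕ.<ᵇ s in eq
... | true  = contradiction (below⇒< s j eq) (ℕP.≤⇒≯ h)
... | false = ≡.refl

count-below : ∀ s n → s ℕ.≤ n → s ℕ.≤ count (below s {n})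
count-below zero    n       h       = z≤n
count-below (suc s) (suc n) (s≤s h) = s≤s (count-below s n h)

punchOut-adjacent : ∀ {n} {j u v : Fin (suc n)} (j≢u : j ≢ u) (j≢v : j ≢ v) →
  toℕ v ≡ suc (toℕ u) → toℕ (punchOut j≢v) ≡ suc (toℕ (punchOut j≢u))
punchOut-adjacent {_}     {zero}  {zero}  {v}     j≢u j≢v e = contradiction ≡.refl j≢u
punchOut-adjacent {_}     {zero}  {suc u} {suc v} j≢u j≢v e = ℕP.suc-injective e
punchOut-adjacent {suc n} {suc zero}    {zero}  {suc zero} j≢u j≢v e = contradiction ≡.refl j≢v
punchOut-adjacent {suc (suc n)} {suc (suc j)} {zero}  {suc zero} j≢u j≢v e = ≡.refl
punchOut-adjacent {suc n} {suc j} {suc u} {suc v} j≢u j≢v e =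
  ≡.cong suc (punchOut-adjacent (j≢u ∘ ≡.cong suc) (j≢v ∘ ≡.cong suc) (ℕP.suc-injective e))

-- This is why the minors at two adjacent columns agree when the columns do: at a single place, each
-- minor keeps the column that the other one deletes.
punchIn-adjacent : ∀ {n} (u v : Fin (suc n)) → toℕ v ≡ suc (toℕ u) → ∀ k →
  (punchIn u k ≡ punchIn v k) ⊎ (punchIn u k ≡ v × punchIn v k ≡ u)
punchIn-adjacent zero (suc zero)    e zero    = inj₂ (≡.refl , ≡.refl)
punchIn-adjacent zero (suc zero)    e (suc k) = inj₁ ≡.refl
punchIn-adjacent (suc u) (suc v) e zero    = inj₁ ≡.refl
punchIn-adjacent (suc u) (suc v) e (suc k) with punchIn-adjacent u v (ℕP.suc-injective e) k
... | inj₁ q        = inj₁ (≡.cong suc q)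
... | inj₂ (q , q′) = inj₂ (≡.cong suc q , ≡.cong suc q′)

module Determinants {c ℓ : Level} (R : CommutativeRing c ℓ) where
  open CommutativeRing R hiding (zero; ring)
  open Alg R
  open Algebra.Properties.Ring (CommutativeRing.ring R) using (-‿distribˡ-*)
  open Relation.Binary.Reasoning.Setoid setoid

  open Algebra.Solver.Ring.NaturalCoefficients.Default commutativeSemiring using (solve; _:=_; _:+_; _:*_)

  sumFin-cong : ∀ {n} {f g : Fin n → Carrier} → (∀ i → f i ≈ g i) → sumFin f ≈ sumFin g
  sumFin-cong {zero}  h = refl
  sumFin-cong {suc n} h = +-cong (h zero) (sumFin-cong (h ∘ suc))

  sumFin-zero : ∀ {n} {f : Fin n → Carrier} → (∀ i → f i ≈ 0#) → sumFin f ≈ 0#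
  sumFin-zero {zero}  h = refl
  sumFin-zero {suc n} h = trans (+-cong (h zero) (sumFin-zero (h ∘ suc))) (+-identityˡ 0#)

  sumFin-linear : ∀ {n} w {f g h : Fin n → Carrier} → (∀ i → f i ≈ g i + w * h i) →
    sumFin f ≈ sumFin g + w * sumFin h
  sumFin-linear {zero}  w e = sym (trans (+-identityˡ _) (zeroʳ w))
  sumFin-linear {suc n} w e =
    trans (+-cong (e zero) (sumFin-linear w (e ∘ suc)))
      (solve 5 (λ a b c d w → (a :+ w :* b) :+ (c :+ w :* d) := (a :+ c) :+ w :* (b :+ d)) refl _ _ _ _ w)

  sumFin-cancel : ∀ {n} {f : Fin n → Carrier} u v → toℕ v ≡ suc (toℕ u) → f u + f v ≈ 0# →
    (∀ i → i ≢ u → i ≢ v → f i ≈ 0#) → sumFin f ≈ 0#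
  sumFin-cancel {f = f} zero (suc zero) e h z = begin
    f zero + (f (suc zero) + _)  ≈⟨ +-assoc _ _ _ ⟨
    (f zero + f (suc zero)) + _  ≈⟨ +-cong h (sumFin-zero (λ i → z (suc (suc i)) (λ ()) (λ ()))) ⟩
    0# + 0#                      ≈⟨ +-identityˡ 0# ⟩
    0#                           ∎
  sumFin-cancel (suc u) (suc v) e h z = trans
    (+-cong (z zero (λ ()) (λ ())) (sumFin-cancel u v (ℕP.suc-injective e) h
      (λ i p q → z (suc i) (p ∘ FinP.suc-injective) (q ∘ FinP.suc-injective))))
    (+-identityˡ 0#)

  term-zeroˡ : ∀ {s x d} → x ≈ 0# → s * (x * d) ≈ 0#
  term-zeroˡ e = trans (*-congˡ (trans (*-congʳ e) (zeroˡ _))) (zeroʳ _)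

  term-zeroʳ : ∀ {s x d} → d ≈ 0# → s * (x * d) ≈ 0#
  term-zeroʳ e = trans (*-congˡ (trans (*-congˡ e) (zeroʳ _))) (zeroʳ _)

  det-cong : ∀ n {M N : Fin n → Fin n → Carrier} → (∀ i j → M i j ≈ N i j) → det n M ≈ det n N
  det-cong zero    h = refl
  det-cong (suc n) h = sumFin-cong (λ j →
    *-congˡ {sign (toℕ j)} (*-cong (h zero j) (det-cong n (λ i k → h (suc i) (punchIn j k)))))

  -- Multilinearity is phrased as a relation between three given matrices, so that `det-step` can
  -- apply it to path matrices as they stand.
  det-column-linear : ∀ n {M A B : Fin n → Fin n → Carrier} w u →
    (∀ i → M i u ≈ A i u + w * B i u) →
    (∀ i j → j ≢ u → M i j ≈ A i j) → (∀ i j → j ≢ u → M i j ≈ B i j) →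
    det n M ≈ det n A + w * det n B
  det-column-linear (suc n) {M} {A} {B} w u hu hA hB = sumFin-linear w term
    where
    minor : (Fin (suc n) → Fin (suc n) → Carrier) → Fin (suc n) → Carrier
    minor N j = det n (λ i k → N (suc i) (punchIn j k))
    term : ∀ j → sign (toℕ j) * (M zero j * minor M j)
      ≈ sign (toℕ j) * (A zero j * minor A j) + w * (sign (toℕ j) * (B zero j * minor B j))
    term j with j FinP.≟ u
    ... | yes ≡.refl = begin
      sign (toℕ j) * (M zero j * minor M j)
        ≈⟨ *-congˡ (*-congʳ (hu zero)) ⟩
      sign (toℕ j) * ((A zero j + w * B zero j) * minor M j)
        ≈⟨ solve 5 (λ s w x y d → s :* ((x :+ w :* y) :* d) := s :* (x :* d) :+ w :* (s :* (y :* d))) refl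
             _ w _ _ _ ⟩
      sign (toℕ j) * (A zero j * minor M j) + w * (sign (toℕ j) * (B zero j * minor M j))
        ≈⟨ +-cong (*-congˡ (*-congˡ (det-cong n (λ i k → hA (suc i) _ (FinP.punchInᵢ≢i j k)))))
                  (*-congˡ (*-congˡ (*-congˡ (det-cong n (λ i k → hB (suc i) _ (FinP.punchInᵢ≢i j k)))))) ⟩
      _ ∎
    ... | no j≢u = begin
      sign (toℕ j) * (M zero j * minor M j)
        ≈⟨ *-congˡ (*-congˡ (det-column-linear n w (punchOut j≢u) hu′
             (λ i k k≢ → hA (suc i) _ (k≢ ∘ out k)) (λ i k k≢ → hB (suc i) _ (k≢ ∘ out k)))) ⟩
      sign (toℕ j) * (M zero j * (minor A j + w * minor B j))
        ≈⟨ solve 5 (λ s w x d e → s :* (x :* (d :+ w :* e)) := s :* (x :* d) :+ w :* (s :* (x :* e))) refl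
             _ w _ _ _ ⟩
      sign (toℕ j) * (M zero j * minor A j) + w * (sign (toℕ j) * (M zero j * minor B j))
        ≈⟨ +-cong (*-congˡ (*-congʳ (hA zero j j≢u))) (*-congˡ (*-congˡ (*-congʳ (hB zero j j≢u)))) ⟩
      _ ∎
      where
      back : punchIn j (punchOut j≢u) ≡ u
      back = FinP.punchIn-punchOut j≢u
      out : ∀ k → punchIn j k ≡ u → k ≡ punchOut j≢u
      out k e = FinP.punchIn-injective j _ _ (≡.trans e (≡.sym back))
      hu′ : ∀ i → M (suc i) (punchIn j (punchOut j≢u))
        ≈ A (suc i) (punchIn j (punchOut j≢u)) + w * B (suc i) (punchIn j (punchOut j≢u))
      hu′ i = ≡.subst (λ l → M (suc i) l ≈ A (suc i) l + w * B (suc i) l) (≡.sym back) (hu (suc i))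

  -- The terms at `u` and `v` have equal entries, equal minors and opposite signs. Every other minor
  -- still contains both columns side by side. Adjacent columns suffice here, because a blocked path
  -- collides with that of its left neighbour.
  det-equal-columns : ∀ n {M : Fin n → Fin n → Carrier} u v → toℕ v ≡ suc (toℕ u) →
    (∀ i → M i u ≈ M i v) → det n M ≈ 0#
  det-equal-columns (suc n) {M} u v e h = sumFin-cancel u v e cancel others
    where
    minor-eq : ∀ i k → M (suc i) (punchIn u k) ≈ M (suc i) (punchIn v k)
    minor-eq i k with punchIn-adjacent u v e k
    ... | inj₁ q        = reflexive (≡.cong (M (suc i)) q)
    ... | inj₂ (q , q′) = trans (reflexive (≡.cong (M (suc i)) q))
                            (trans (sym (h (suc i))) (reflexive (≡.cong (M (suc i)) (≡.sym q′))))
    cancel : sign (toℕ u) * (M zero u * det n (λ i k → M (suc i) (punchIn u k)))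
      + sign (toℕ v) * (M zero v * det n (λ i k → M (suc i) (punchIn v k))) ≈ 0#
    cancel rewrite e = begin
      _ ≈⟨ +-cong (*-congˡ (*-cong (h zero) (det-cong n minor-eq))) (sym (-‿distribˡ-* _ _)) ⟩
      _ ≈⟨ -‿inverseʳ _ ⟩
      0# ∎
    others : ∀ j → j ≢ u → j ≢ v → sign (toℕ j) * (M zero j * det n (λ i k → M (suc i) (punchIn j k))) ≈ 0#
    others j j≢u j≢v = term-zeroʳ (det-equal-columns n (punchOut j≢u) (punchOut j≢v)
      (punchOut-adjacent j≢u j≢v e)
      (λ i → trans (reflexive (≡.cong (M (suc i)) (FinP.punchIn-punchOut j≢u)))
        (trans (h (suc i)) (reflexive (≡.cong (M (suc i)) (≡.sym (FinP.punchIn-punchOut j≢v)))))))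

  det-row₀ : ∀ n {M : Fin (suc n) → Fin (suc n) → Carrier} → (∀ j → M zero (suc j) ≈ 0#) →
    det (suc n) M ≈ M zero zero * det n (λ i k → M (suc i) (suc k))
  det-row₀ n h = trans (+-cong (*-identityˡ _) (sumFin-zero (λ j → term-zeroˡ (h j)))) (+-identityʳ _)

  LowerTriangular : ∀ {n} → (Fin n → Fin n → Carrier) → Set ℓ
  LowerTriangular M = ∀ i j → toℕ i ℕ.< toℕ j → M i j ≈ 0#

  det-unitriangular : ∀ n {M : Fin n → Fin n → Carrier} → LowerTriangular M →
    (∀ i → M i i ≈ 1#) → det n M ≈ 1#
  det-unitriangular zero    t d = refl
  det-unitriangular (suc n) {M} t d = trans (det-row₀ n {M} (λ j → t zero (suc j) (s≤s z≤n)))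
    (trans (*-cong (d zero) (det-unitriangular n (λ i j p → t (suc i) (suc j) (s≤s p)) (d ∘ suc))) (*-identityˡ 1#))

  det-triangular-zero : ∀ n {M : Fin n → Fin n → Carrier} → LowerTriangular M →
    ∀ u → M u u ≈ 0# → det n M ≈ 0#
  det-triangular-zero (suc n) {M} t zero    e = trans (det-row₀ n {M} (λ j → t zero (suc j) (s≤s z≤n)))
    (trans (*-congʳ e) (zeroˡ _))
  det-triangular-zero (suc n) {M} t (suc u) e = trans (det-row₀ n {M} (λ j → t zero (suc j) (s≤s z≤n)))
    (trans (*-congˡ (det-triangular-zero n (λ i j p → t (suc i) (suc j) (s≤s p)) u e)) (zeroʳ _))

  ZeroBlock : ∀ {n} → ℕ → (Fin n → Bool) → (Fin n → Fin n → Carrier) → Set ℓ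
  ZeroBlock s C M = ∀ i j → s ℕ.≤ toℕ i → C j ≡ true → M i j ≈ 0#

  -- The easy half of the Frobenius–König theorem.
  det-zero-block : ∀ n {M : Fin n → Fin n → Carrier} s (C : Fin n → Bool) →
    ZeroBlock s C M → s ℕ.< count C → det n M ≈ 0#
  det-zero-block (suc n) {M} zero C z h = sumFin-zero term
    where
    term : ∀ j → sign (toℕ j) * (M zero j * det n (λ i k → M (suc i) (punchIn j k))) ≈ 0#
    term j with C j in eq
    ... | true  = term-zeroˡ (z zero j z≤n eq)
    -- The deleted column lies outside the block, so the minor keeps all columns of the block.
    ... | false = term-zeroʳ (det-zero-block n zero (C ∘ punchIn j)
                    (λ i k _ → z (suc i) (punchIn j k) z≤n) (count-minor-∉ C j eq h))
  det-zero-block (suc n) {M} (suc s) C z h = sumFin-zero (λ j → term-zeroʳ {sign (toℕ j)} {M zero j}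
    (det-zero-block n s (C ∘ punchIn j) (λ i k p → z (suc i) (punchIn j k) (s≤s p)) (count-minor C j h)))

  -- A permutation through such an entry (i , j) cannot avoid the zero block.
  Irrelevant : ∀ {n} → (M N : Fin n → Fin n → Carrier) → Fin n → Fin n → Set ℓ
  Irrelevant {n} M N i j = Σ[ s ∈ ℕ ] Σ[ C ∈ (Fin n → Bool) ]
    toℕ i ℕ.< s × C j ≡ false × s ℕ.≤ count C × ZeroBlock s C M × ZeroBlock s C N

  -- Pigeonhole: the rows from `s` on must be matched with columns outside `C`, of which there are
  -- no more than such rows, so none is left for a row above them. Deleting row 0 and any column
  -- preserves such a certificate for the lower rows. At an irrelevant entry of row 0 itself no
  -- column of `C` is lost, and the block becomes large enough for `det-zero-block`.
  det-cong-relevant : ∀ n {M N : Fin n → Fin n → Carrier} →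
    (∀ i j → (M i j ≈ N i j) ⊎ Irrelevant M N i j) → det n M ≈ det n N
  det-cong-relevant zero    h = refl
  det-cong-relevant (suc n) {M} {N} h = sumFin-cong term
    where
    minors : ∀ j i k → (M (suc i) (punchIn j k) ≈ N (suc i) (punchIn j k))
      ⊎ Irrelevant (λ i k → M (suc i) (punchIn j k)) (λ i k → N (suc i) (punchIn j k)) i k
    minors j i k with h (suc i) (punchIn j k)
    ... | inj₁ e = inj₁ e
    ... | inj₂ (suc s , C , s≤s i<s , ¬c , s<C , zM , zN) = inj₂
      (s , C ∘ punchIn j , i<s , ¬c , count-minor C j s<C ,
       (λ i k p → zM (suc i) (punchIn j k) (s≤s p)) , (λ i k p → zN (suc i) (punchIn j k) (s≤s p)))
    term : ∀ j → sign (toℕ j) * (M zero j * det n (λ i k → M (suc i) (punchIn j k)))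
      ≈ sign (toℕ j) * (N zero j * det n (λ i k → N (suc i) (punchIn j k)))
    term j with h zero j
    ... | inj₁ e = *-congˡ (*-cong e (det-cong-relevant n (minors j)))
    ... | inj₂ (suc s , C , _ , ¬c , s<C , zM , zN) = trans (vanish M zM) (sym (vanish N zN))
      where
      vanish : ∀ N → ZeroBlock (suc s) C N →
        sign (toℕ j) * (N zero j * det n (λ i k → N (suc i) (punchIn j k))) ≈ 0#
      vanish N z = term-zeroʳ (det-zero-block n s (C ∘ punchIn j)
        (λ i k p → z (suc i) (punchIn j k) (s≤s p)) (count-minor-∉ C j ¬c s<C))

-- Super elementary symmetric functions

-- Linear arithmetic is reduced to ring identities: an inequality follows once the difference of its
-- sides equals one known to be nonnegative (below, a sum of two such), and the solver checks the
-- identity.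
≤-linear : ∀ {a b c d} → a ℤ.≤ b → d ℤ.- c ≡ b ℤ.- a → c ℤ.≤ d
≤-linear h e = ℤP.0≤i-j⇒j≤i (≡.subst (+ 0 ℤ.≤_) (≡.sym e) (ℤP.i≤j⇒0≤j-i h))

≤-linear₂ : ∀ {a b a′ b′ c d} → a ℤ.≤ b → a′ ℤ.≤ b′ → d ℤ.- c ≡ (b ℤ.- a) ℤ.+ (b′ ℤ.- a′) → c ℤ.≤ d
≤-linear₂ h h′ e = ℤP.0≤i-j⇒j≤i
  (≡.subst (+ 0 ℤ.≤_) (≡.sym e) (ℤP.+-mono-≤ (ℤP.i≤j⇒0≤j-i h) (ℤP.i≤j⇒0≤j-i h′)))

≤⇒+ : ∀ {i j} → i ℤ.≤ j → ∃ λ k → j ≡ i ℤ.+ + k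
≤⇒+ {i} {j} h = ℤ.∣ j ℤ.- i ∣ , ≡.sym (≡.trans (≡.cong (λ u → i ℤ.+ u) (ℤP.0≤i⇒+∣i∣≡i (ℤP.i≤j⇒0≤j-i h)))
  (solveℤ 2 (λ i j → i ⊹ (j ⊟ i) ⊜ j) ≡.refl i j))

applyUpTo-cong : ∀ {a} {A : Set a} {g h : ℕ → A} l → (∀ k → k ℕ.< l → g k ≡ h k) → applyUpTo g l ≡ applyUpTo h l
applyUpTo-cong zero    e = ≡.refl
applyUpTo-cong (suc l) e = ≡.cong₂ _∷_ (e 0 (s≤s z≤n)) (applyUpTo-cong l (λ k p → e (suc k) (s≤s p)))

seg-step : ∀ {a} {A : Set a} (f : ℤ → A) s k →
  applyUpTo (λ t → f (s ℤ.+ + t)) (suc k) ≡ f s ∷ applyUpTo (λ t → f (ℤ.suc s ℤ.+ + t)) k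
seg-step f s k = ≡.cong₂ _∷_ (≡.cong f (ℤP.+-identityʳ s)) (applyUpTo-cong k
  (λ t _ → ≡.cong f (solveℤ 2 (λ s t → s ⊹ (K̂ (+ 1) ⊹ t) ⊜ (K̂ (+ 1) ⊹ s) ⊹ t) ≡.refl s (+ t))))

seg-applyUpTo : ∀ {a} {A : Set a} (f : ℤ → A) s k →
  seg f (ℤ.suc s) (s ℤ.+ + k) ≡ applyUpTo (λ t → f (ℤ.suc s ℤ.+ + t)) k
seg-applyUpTo f s k rewrite solveℤ 2 (λ s k → s ⊹ k ⊟ (K̂ (+ 1) ⊹ s) ⊜ k ⊟ K̂ (+ 1)) ≡.refl s (+ k) with k
... | zero  = ≡.refl
... | suc k = ListP.map-upTo _ (suc k)

seg-∷ : ∀ {a} {A : Set a} (f : ℤ → A) {s e} → s ℤ.≤ e → seg f s e ≡ f s ∷ seg f (ℤ.suc s) e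
seg-∷ f {s} h with ≤⇒+ h
... | k , ≡.refl = ≡.trans (whole k) (≡.cong (f s ∷_) (≡.sym (seg-applyUpTo f s k)))
  where
  whole : ∀ k → seg f s (s ℤ.+ + k) ≡ f s ∷ applyUpTo (λ t → f (ℤ.suc s ℤ.+ + t)) k
  whole k rewrite solveℤ 2 (λ s k → s ⊹ k ⊟ s ⊜ k) ≡.refl s (+ k) =
    ≡.trans (ListP.map-upTo _ (suc k)) (seg-step f s k)

seg-length : ∀ {a} {A : Set a} (f : ℤ → A) s e k → ℤ.suc e ℤ.≤ s ℤ.+ + k → length (seg f s e) ℕ.≤ k
seg-length f s e k h with e ℤ.- s in eq
... | -[1+ _ ] = z≤n
... | + l      = ≡.subst (ℕ._≤ k) (≡.sym (≡.trans (≡.cong length (ListP.map-upTo (λ t → f (s ℤ.+ + t)) (suc l)))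
                   (ListP.length-applyUpTo (λ t → f (s ℤ.+ + t)) (suc l))))
                   (ℤP.drop‿+≤+ (≤-linear h (≡.trans (≡.cong (λ u → + k ℤ.- (+ 1 ℤ.+ u)) (≡.sym eq))
                     (solveℤ 3 (λ k s e → k ⊟ (K̂ (+ 1) ⊹ (e ⊟ s)) ⊜ (s ⊹ k) ⊟ (K̂ (+ 1) ⊹ e)) ≡.refl (+ k) s e))))

seg-[] : ∀ {a} {A : Set a} (f : ℤ → A) {s e} → e ℤ.< s → seg f s e ≡ []
seg-[] f {s} {e} h = length-0 (seg-length f s e 0
  (≡.subst (ℤ.suc e ℤ.≤_) (≡.sym (ℤP.+-identityʳ s)) (ℤP.i<j⇒suc[i]≤j h)))
  where
  length-0 : ∀ {a} {A : Set a} {xs : List A} → length xs ℕ.≤ 0 → xs ≡ []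
  length-0 {xs = []} z≤n = ≡.refl

module SuperElementary {c ℓ : Level} (R : CommutativeRing c ℓ) where
  open CommutativeRing R hiding (zero; ring)
  open Alg R
  open Algebra.Properties.Ring (CommutativeRing.ring R) using (-‿distribˡ-*)
  open Relation.Binary.Reasoning.Setoid setoid
  open Algebra.Solver.Ring.NaturalCoefficients.Default commutativeSemiring using (solve; _:=_; _:+_; _:*_)

  sumN : ℕ → (ℕ → Carrier) → Carrier
  sumN zero    f = 0#
  sumN (suc m) f = f 0 + sumN m (f ∘ suc)

  sumTo≡sumN : ∀ m f → sumTo m f ≡ sumN (suc m) f
  sumTo≡sumN m f = go (suc m) id
    where
    go : ∀ m (g : ℕ → ℕ) → foldr (λ i acc → f i + acc) 0# (applyUpTo g m) ≡ sumN m (f ∘ g)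
    go zero    g = ≡.refl
    go (suc m) g = ≡.cong (λ u → f (g 0) + u) (go m (g ∘ suc))

  sumN-zero : ∀ m {f} → (∀ i → i ℕ.< m → f i ≈ 0#) → sumN m f ≈ 0#
  sumN-zero zero    h = refl
  sumN-zero (suc m) h = trans (+-cong (h 0 (s≤s z≤n)) (sumN-zero m (λ i p → h (suc i) (s≤s p)))) (+-identityˡ 0#)

  sumN-linear : ∀ m w {f g h} → (∀ i → i ℕ.< m → f i ≈ g i + w * h i) → sumN m f ≈ sumN m g + w * sumN m h
  sumN-linear zero    w e = sym (trans (+-identityˡ _) (zeroʳ w))
  sumN-linear (suc m) w e = trans
    (+-cong (e 0 (s≤s z≤n)) (sumN-linear m w (λ i p → e (suc i) (s≤s p))))
    (solve 5 (λ a b c d w → (a :+ w :* b) :+ (c :+ w :* d) := (a :+ c) :+ w :* (b :+ d)) refl _ _ _ _ w)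

  sumN-last : ∀ m f → sumN (suc m) f ≈ sumN m f + f m
  sumN-last zero    f = +-comm _ _
  sumN-last (suc m) f = trans (+-congˡ (sumN-last m (f ∘ suc))) (sym (+-assoc _ _ _))

  eSuperTerm : ℕ → List Carrier → List Carrier → ℕ → Carrier
  eSuperTerm m xs zs i = sign (m ∸ i) * (eSym i xs * hSym (m ∸ i) zs)

  eSuper≈ : ∀ m xs zs → eSuper (+ m) xs zs ≈ sumN (suc m) (eSuperTerm m xs zs)
  eSuper≈ m xs zs = reflexive (sumTo≡sumN m _)

  eSuper-zero : ∀ xs zs → eSuper (+ 0) xs zs ≈ 1#
  eSuper-zero xs zs = trans (+-identityʳ _) (trans (*-identityˡ _) (*-identityˡ _))

  eSuper-consˡ : ∀ m x xs zs →
    eSuper (+ suc m) (x ∷ xs) zs ≈ eSuper (+ suc m) xs zs + x * eSuper (+ m) xs zs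
  eSuper-consˡ m x xs zs = begin
    eSuper (+ suc m) (x ∷ xs) zs
      ≈⟨ eSuper≈ (suc m) (x ∷ xs) zs ⟩
    eSuperTerm (suc m) xs zs 0 + sumN (suc m) (eSuperTerm (suc m) (x ∷ xs) zs ∘ suc)
      ≈⟨ +-congˡ (sumN-linear (suc m) x (λ i _ →
           solve 5 (λ s e x e′ h → s :* ((e :+ x :* e′) :* h) := s :* (e :* h) :+ x :* (s :* (e′ :* h))) refl
             (sign (m ∸ i)) (eSym (suc i) xs) x (eSym i xs) (hSym (m ∸ i) zs))) ⟩
    eSuperTerm (suc m) xs zs 0 +
      (sumN (suc m) (eSuperTerm (suc m) xs zs ∘ suc) + x * sumN (suc m) (eSuperTerm m xs zs))
      ≈⟨ +-assoc _ _ _ ⟨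
    sumN (suc (suc m)) (eSuperTerm (suc m) xs zs) + x * sumN (suc m) (eSuperTerm m xs zs)
      ≈⟨ +-cong (sym (eSuper≈ (suc m) xs zs)) (*-congˡ (sym (eSuper≈ m xs zs))) ⟩
    _ ∎

  -- In the generating function ∏(1 + x u) / ∏(1 + z u) the factor 1 + z u is cleared from the
  -- denominator, which is why the term of lower degree keeps `z` in its list.
  eSuper-consʳ : ∀ m xs z zs →
    eSuper (+ suc m) xs (z ∷ zs) ≈ eSuper (+ suc m) xs zs + - z * eSuper (+ m) xs (z ∷ zs)
  eSuper-consʳ m xs z zs = begin
    eSuper (+ suc m) xs (z ∷ zs)
      ≈⟨ trans (eSuper≈ (suc m) xs (z ∷ zs)) (sumN-last (suc m) (eSuperTerm (suc m) xs (z ∷ zs))) ⟩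
    sumN (suc m) (eSuperTerm (suc m) xs (z ∷ zs)) + eSuperTerm (suc m) xs (z ∷ zs) (suc m)
      ≈⟨ +-cong (sumN-linear (suc m) (- z) term) last ⟩
    (sumN (suc m) (eSuperTerm (suc m) xs zs) + - z * sumN (suc m) (eSuperTerm m xs (z ∷ zs)))
      + eSuperTerm (suc m) xs zs (suc m)
      ≈⟨ solve 3 (λ a b c → (a :+ b) :+ c := (a :+ c) :+ b) refl _ _ _ ⟩
    (sumN (suc m) (eSuperTerm (suc m) xs zs) + eSuperTerm (suc m) xs zs (suc m))
      + - z * sumN (suc m) (eSuperTerm m xs (z ∷ zs))
      ≈⟨ +-cong (sym (trans (eSuper≈ (suc m) xs zs) (sumN-last (suc m) (eSuperTerm (suc m) xs zs))))
           (*-congˡ (sym (eSuper≈ m xs (z ∷ zs)))) ⟩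
    _ ∎
    where
    last : eSuperTerm (suc m) xs (z ∷ zs) (suc m) ≈ eSuperTerm (suc m) xs zs (suc m)
    last rewrite ℕP.n∸n≡0 m = refl
    flip-sign : ∀ s e h → - s * (e * (z * h)) ≈ - z * (s * (e * h))
    flip-sign s e h = begin
      - s * (e * (z * h))   ≈⟨ -‿distribˡ-* _ _ ⟨
      - (s * (e * (z * h))) ≈⟨ -‿cong (solve 4 (λ s e z h → s :* (e :* (z :* h)) := z :* (s :* (e :* h))) refl s e z h) ⟩
      - (z * (s * (e * h))) ≈⟨ -‿distribˡ-* _ _ ⟩
      - z * (s * (e * h))   ∎
    term : ∀ i → i ℕ.< suc m → eSuperTerm (suc m) xs (z ∷ zs) i
      ≈ eSuperTerm (suc m) xs zs i + - z * eSuperTerm m xs (z ∷ zs) i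
    term i (s≤s i≤m) rewrite ℕP.+-∸-assoc 1 i≤m = begin
      - sign (m ∸ i) * (eSym i xs * (hSym (suc (m ∸ i)) zs + z * hSym (m ∸ i) (z ∷ zs)))
        ≈⟨ solve 4 (λ s e h h′ → s :* (e :* (h :+ h′)) := s :* (e :* h) :+ s :* (e :* h′)) refl
             (- sign (m ∸ i)) (eSym i xs) _ _ ⟩
      _ ≈⟨ +-congˡ (flip-sign (sign (m ∸ i)) (eSym i xs) (hSym (m ∸ i) (z ∷ zs))) ⟩
      _ ∎

  eSuper-cons : ∀ m x xs z zs → eSuper (+ suc m) (x ∷ xs) (z ∷ zs)
    ≈ eSuper (+ suc m) xs zs + (x - z) * eSuper (+ m) xs (z ∷ zs)
  eSuper-cons m x xs z zs = begin
    _ ≈⟨ eSuper-consˡ m x xs (z ∷ zs) ⟩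
    _ ≈⟨ +-congʳ (eSuper-consʳ m xs z zs) ⟩
    _ ≈⟨ solve 4 (λ a x z′ e → (a :+ z′ :* e) :+ x :* e := a :+ (x :+ z′) :* e) refl
           _ x (- z) (eSuper (+ m) xs (z ∷ zs)) ⟩
    _ ∎

  eSym-large : ∀ k xs → length xs ℕ.< k → eSym k xs ≈ 0#
  eSym-large (suc k) []       h       = refl
  eSym-large (suc k) (x ∷ xs) (s≤s h) = begin
    eSym (suc k) xs + x * eSym k xs ≈⟨ +-cong (eSym-large (suc k) xs (ℕP.m≤n⇒m≤1+n h)) (*-congˡ (eSym-large k xs h)) ⟩
    0# + x * 0#                     ≈⟨ trans (+-identityˡ _) (zeroʳ x) ⟩
    0#                              ∎

  eSuper-large : ∀ m xs → length xs ℕ.< m → eSuper (+ m) xs [] ≈ 0#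
  eSuper-large m xs h = trans (eSuper≈ m xs []) (sumN-zero (suc m) term)
    where
    term : ∀ i → i ℕ.< suc m → eSuperTerm m xs [] i ≈ 0#
    -- Either `i` exceeds the number of variables, or a complete function of positive degree is
    -- evaluated at no variables.
    term i (s≤s i≤m) with m ∸ i in eq
    ... | zero  = trans (*-identityˡ _) (trans (*-congʳ (eSym-large i xs
                    (ℕP.≤-trans h (ℕP.m∸n≡0⇒m≤n eq)))) (zeroˡ _))
    ... | suc _ = trans (*-congˡ (zeroʳ _)) (zeroʳ _)

  -- The entry of the flagged determinant in a row with end position q and upper flag e, seen from a path
  -- that stands at position p before time t: p = i − j for a step through the cell (i , j), indices from 0.
  module Entry (y z : ℤ → Carrier) (κ q e : ℤ) where

    entry : ℤ → ℤ → Carrier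
    entry t p = eSuper (q ℤ.- p) (seg y t e) (seg z (t ℤ.+ (κ ℤ.- p)) (e ℤ.+ (κ ℤ.- ℤ.pred q)))

    entry-beyond : ∀ t {p} → q ℤ.< p → entry t p ≈ 0#
    entry-beyond t {p} h with ≤⇒+ (ℤP.i<j⇒suc[i]≤j h)
    ... | k , ≡.refl rewrite solveℤ 2 (λ q k → q ⊟ (K̂ (+ 1) ⊹ q ⊹ k) ⊜ K̂ (+ 0) ⊟ (K̂ (+ 1) ⊹ k)) ≡.refl q (+ k) = refl

    entry-diagonal : ∀ t → entry t q ≈ 1#
    entry-diagonal t rewrite solveℤ 1 (λ q → q ⊟ q ⊜ K̂ (+ 0)) ≡.refl q =
      eSuper-zero (seg y t e) (seg z (t ℤ.+ (κ ℤ.- q)) (e ℤ.+ (κ ℤ.- ℤ.pred q)))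

    -- Being late empties the list of z. An ordinary elementary function remains, and its degree
    -- `q − p` exceeds the number of times from `t` to `e`.
    entry-late : ∀ t {p} → p ℤ.< q → e ℤ.- ℤ.pred q ℤ.< t ℤ.- p → entry t p ≈ 0#
    entry-late t {p} p<q late with ≤⇒+ (ℤP.i<j⇒suc[i]≤j p<q)
    ... | k , ≡.refl = begin
      entry t p ≡⟨ ≡.cong₂ (λ d zs → eSuper d (seg y t e) zs)
                    (solveℤ 2 (λ p k → (K̂ (+ 1) ⊹ p ⊹ k) ⊟ p ⊜ K̂ (+ 1) ⊹ k) ≡.refl p (+ k))
                    (seg-[] z {t ℤ.+ (κ ℤ.- p)} {e ℤ.+ (κ ℤ.- ℤ.pred q)} (ℤP.suc[i]≤j⇒i<j (≤-linear late′
                      (solveℤ 5 (λ t κ p e r → t ⊹ (κ ⊟ p) ⊟ (K̂ (+ 1) ⊹ (e ⊹ (κ ⊟ r)))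
                         ⊜ (t ⊟ p) ⊟ (K̂ (+ 1) ⊹ (e ⊟ r))) ≡.refl t κ p e (ℤ.pred q))))) ⟩
      eSuper (+ suc k) (seg y t e) [] ≈⟨ eSuper-large (suc k) (seg y t e) (s≤s (seg-length y t e k
          (≤-linear late′ (solveℤ 4 (λ t k e p → (t ⊹ k) ⊟ (K̂ (+ 1) ⊹ e)
            ⊜ (t ⊟ p) ⊟ (K̂ (+ 1) ⊹ (e ⊟ (K̂ (ℤ.- + 1) ⊹ (K̂ (+ 1) ⊹ p ⊹ k))))) ≡.refl t (+ k) e p)))) ⟩
      0# ∎
      where
      late′ : ℤ.suc (e ℤ.- ℤ.pred q) ℤ.≤ t ℤ.- p
      late′ = ℤP.i<j⇒suc[i]≤j late

    -- `early` says precisely that the list of z is nonempty, and together with `p < q` it gives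
    -- `t ≤ e`. That list starts at an index depending on `t − p` only, hence at the same place
    -- after a step; this matches the term of lower degree in `eSuper-cons`, which keeps `z`.
    entry-step : ∀ t {p} → p ℤ.< q → t ℤ.- p ℤ.≤ e ℤ.- ℤ.pred q →
      entry t p ≈ entry (ℤ.suc t) p + (y t - z (t ℤ.+ (κ ℤ.- p))) * entry (ℤ.suc t) (ℤ.suc p)
    entry-step t {p} p<q early with ≤⇒+ (ℤP.i<j⇒suc[i]≤j p<q)
    ... | k , ≡.refl = begin
      entry t p
        ≡⟨ ≡.cong (λ d → eSuper d (seg y t e) (seg z s e′)) deg₁ ⟩
      eSuper (+ suc k) (seg y t e) (seg z s e′)
        ≡⟨ ≡.cong₂ (eSuper (+ suc k)) (seg-∷ y t≤e) (seg-∷ z s≤e′) ⟩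
      eSuper (+ suc k) (y t ∷ seg y (ℤ.suc t) e) (z s ∷ seg z (ℤ.suc s) e′)
        ≈⟨ eSuper-cons k (y t) (seg y (ℤ.suc t) e) (z s) (seg z (ℤ.suc s) e′) ⟩
      eSuper (+ suc k) (seg y (ℤ.suc t) e) (seg z (ℤ.suc s) e′)
        + (y t - z s) * eSuper (+ k) (seg y (ℤ.suc t) e) (z s ∷ seg z (ℤ.suc s) e′)
        ≡⟨ ≡.cong₂ (λ u v → u + (y t - z s) * v)
             (≡.cong₂ (λ d s → eSuper d (seg y (ℤ.suc t) e) (seg z s e′)) (≡.sym deg₁) (≡.sym (ℤP.+-assoc (+ 1) t (κ ℤ.- p))))
             (≡.cong₂ (λ d → eSuper d (seg y (ℤ.suc t) e)) (≡.sym deg₂)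
               (≡.trans (≡.sym (seg-∷ z s≤e′)) (≡.cong (λ s → seg z s e′) shift))) ⟩
      _ ∎
      where
      s e′ : ℤ
      s  = t ℤ.+ (κ ℤ.- p)
      e′ = e ℤ.+ (κ ℤ.- ℤ.pred q)
      deg₁ : q ℤ.- p ≡ + suc k
      deg₁ = solveℤ 2 (λ p k → (K̂ (+ 1) ⊹ p ⊹ k) ⊟ p ⊜ K̂ (+ 1) ⊹ k) ≡.refl p (+ k)
      deg₂ : q ℤ.- ℤ.suc p ≡ + k
      deg₂ = solveℤ 2 (λ p k → (K̂ (+ 1) ⊹ p ⊹ k) ⊟ (K̂ (+ 1) ⊹ p) ⊜ k) ≡.refl p (+ k)
      shift : s ≡ ℤ.suc t ℤ.+ (κ ℤ.- ℤ.suc p)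
      shift = solveℤ 3 (λ t κ p → t ⊹ (κ ⊟ p) ⊜ (K̂ (+ 1) ⊹ t) ⊹ (κ ⊟ (K̂ (+ 1) ⊹ p))) ≡.refl t κ p
      s≤e′ : s ℤ.≤ e′
      s≤e′ = ≤-linear early (solveℤ 5 (λ t κ p e r → e ⊹ (κ ⊟ r) ⊟ (t ⊹ (κ ⊟ p)) ⊜ (e ⊟ r) ⊟ (t ⊟ p)) ≡.refl
               t κ p e (ℤ.pred q))
      t≤e : t ℤ.≤ e
      t≤e = ≤-linear₂ early (+≤+ (z≤n {k})) (solveℤ 4 (λ t k e p → e ⊟ t
        ⊜ (e ⊟ (K̂ (ℤ.- + 1) ⊹ (K̂ (+ 1) ⊹ p ⊹ k)) ⊟ (t ⊟ p)) ⊹ (k ⊟ K̂ (+ 0))) ≡.refl t (+ k) e p)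

-- Generating tableaux

-- The diagonal i − j of the cell (i , j), rows and columns counted from 0; it is also the position of the
-- lattice path of column j when i cells of that column have been filled.
pos : ℕ → ℕ → ℤ
pos i j = + i ℤ.- + j

-- Abstract, so that with-abstraction does not see the decisions unfolded.
abstract
  eq? : (i j : ℕ) → Dec (i ≡ j)
  eq? = ℕ._≟_

  eqCell? : (i j i′ j′ : ℕ) → Dec (i′ ≡ i × j′ ≡ j)
  eqCell? i j i′ j′ = (i′ ℕ.≟ i) ×-dec (j′ ℕ.≟ j)

bump : (ℕ → ℕ) → ℕ → ℕ → ℕ
bump m j k = if does (eq? k j) then suc (m k) else m k

bump-at : ∀ m j → bump m j j ≡ suc (m j)
bump-at m j with eq? j j
... | yes _  = ≡.refl
... | no j≢j = contradiction ≡.refl j≢j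

bump-≢ : ∀ m {j k} → k ≢ j → bump m j k ≡ m k
bump-≢ m {j} {k} k≢j with eq? k j
... | yes k≡j = contradiction k≡j k≢j
... | no _    = ≡.refl

bump-≥ : ∀ m j k → m k ℕ.≤ bump m j k
bump-≥ m j k with eq? k j
... | yes _ = ℕP.n≤1+n _
... | no _  = ℕP.≤-refl

Decreasing : (ℕ → ℕ) → Set
Decreasing m = ∀ k → m (suc k) ℕ.≤ m k

antitone : ∀ {m} → Decreasing m → ∀ {i j} → i ℕ.≤ j → m j ℕ.≤ m i
antitone {m} d {i} {j} i≤j = go (ℕP.≤⇒≤′ i≤j)
  where
  go : ∀ {j} → i ℕ.≤′ j → m j ℕ.≤ m i
  go ℕ.≤′-refl     = ℕP.≤-refl
  go (ℕ.≤′-step h) = ℕP.≤-trans (d _) (go h)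

FreeLeft : (ℕ → ℕ) → ℕ → Set
FreeLeft m j = ∀ k → j ≡ suc k → m j ℕ.< m k

freeLeft? : ∀ m j → Dec (FreeLeft m j)
freeLeft? m zero    = yes (λ _ ())
freeLeft? m (suc k) = map′ (λ { h _ ≡.refl → h }) (λ h → h k ≡.refl) (m (suc k) ℕ.<? m k)

¬freeLeft : ∀ m j → ¬ FreeLeft m j → ∃ λ k → j ≡ suc k × m k ℕ.≤ m j
¬freeLeft m zero    h = contradiction (λ _ ()) h
¬freeLeft m (suc k) h = k , ≡.refl , ℕP.≮⇒≥ (λ p → h (λ { _ ≡.refl → p }))

bump-decreasing : ∀ {m j} → Decreasing m → FreeLeft m j → Decreasing (bump m j)
bump-decreasing {m} {j} d fl k with eq? (suc k) j
... | no _ = ℕP.≤-trans (d k) (bump-≥ m j k)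
... | yes ≡.refl = ≡.subst (suc (m (suc k)) ℕ.≤_) (≡.sym (bump-≢ m (λ ()))) (fl k ≡.refl)

Filling : Set
Filling = ℕ → ℕ → SEntry

put : ℕ → ℕ → SEntry → Filling → Filling
put i j e f i′ j′ = if does (eqCell? i j i′ j′) then e else f i′ j′

put-at : ∀ i j e f → put i j e f i j ≡ e
put-at i j e f with eqCell? i j i j
... | yes _ = ≡.refl
... | no ¬p = contradiction (≡.refl , ≡.refl) ¬p

put-≢ : ∀ {i j} e f {i′ j′} → ¬ (i′ ≡ i × j′ ≡ j) → put i j e f i′ j′ ≡ f i′ j′
put-≢ {i} {j} e f {i′} {j′} ¬p with eqCell? i j i′ j′
... | yes p = contradiction p ¬p
... | no _  = ≡.refl

Event : ℕ → Set
Event n = ℤ × Fin n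

_≺_ : ∀ {n} → Event n → Event n → Set
(t , u) ≺ (t′ , u′) = t ℤ.< t′ ⊎ (t ≡ t′ × toℕ u ℕ.< toℕ u′)

≺⇒≤ : ∀ {n t t′} {u u′ : Fin n} → (t , u) ≺ (t′ , u′) → t ℤ.≤ t′
≺⇒≤ (inj₁ t<t′)        = ℤP.<⇒≤ t<t′
≺⇒≤ (inj₂ (≡.refl , _)) = ℤP.≤-refl

≺⇒< : ∀ {n t t′} {u : Fin n} → (t , u) ≺ (t′ , u) → t ℤ.< t′
≺⇒< (inj₁ t<t′)      = t<t′
≺⇒< (inj₂ (_ , u<u)) = contradiction u<u (ℕP.<-irrefl ≡.refl)

-- Tableaux are built value by value, and for equal values column by column from the left (the
-- standardization order); the event (t , u) offers to put t on top of the unfilled part of column u.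
module Generation (n : ℕ) (lam : ℕ → ℕ) (κ : ℤ) (Ok : ℤ → ℤ → Set) (ok? : ∀ t p → Dec (Ok t p)) where

  -- Undoes the content shift of a primed entry, so that the underlying integer filling can be read
  -- off a super tableau and need not be stored with it.
  value : ℕ → ℕ → SEntry → ℤ
  value i j (unp t) = t
  value i j (pr t)  = t ℤ.- (κ ℤ.- pos i j)

  primed : ℤ → ℕ → ℕ → SEntry
  primed t i j = pr (t ℤ.+ (κ ℤ.- pos i j))

  value-primed : ∀ t i j → value i j (primed t i j) ≡ t
  value-primed t i j = solveℤ 2 (λ t c → t ⊹ c ⊟ c ⊜ t) ≡.refl t (κ ℤ.- pos i j)

  value-inverse : ∀ i j {t} e → value i j e ≡ t → e ≡ unp t ⊎ e ≡ primed t i j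
  value-inverse i j (unp t) ≡.refl = inj₁ ≡.refl
  value-inverse i j (pr t)  ≡.refl = inj₂ (≡.cong pr (solveℤ 2 (λ t c → t ⊜ t ⊟ c ⊹ c) ≡.refl t (κ ℤ.- pos i j)))

  Cell : (ℕ → ℕ) → ℕ → ℕ → Set
  Cell m i j = m j ℕ.≤ i × i ℕ.< lam j

  abstract
    cell? : ∀ m i j → Dec (Cell m i j)
    cell? m i j = (m j ℕ.≤? i) ×-dec (i ℕ.<? lam j)

  Addable : ℤ → ℕ → (ℕ → ℕ) → Set
  Addable t j m = Ok t (pos (m j) j) × m j ℕ.< lam j × FreeLeft m j

  abstract
    addable? : ∀ t j m → Dec (Addable t j m)
    addable? t j m = ok? t (pos (m j) j) ×-dec ((m j ℕ.<? lam j) ×-dec freeLeft? m j)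

  abstract
    full? : ∀ (m : ℕ → ℕ) → Dec (∀ (u : Fin n) → m (toℕ u) ≡ lam (toℕ u))
    full? m = FinP.all? (λ u → m (toℕ u) ℕ.≟ lam (toℕ u))

  putBoth : ℤ → ℕ → ℕ → List Filling → List Filling
  putBoth t i j fs = map (put i j (unp t)) fs ++ map (put i j (primed t i j)) fs

  -- `m` records how far each column is filled. The first part ignores the event and the second uses
  -- it, parallel to the two terms of `det-step`. The constant filling at the end supplies values
  -- outside the shape and counts only if no cell is left.
  gen : List (Event n) → (ℕ → ℕ) → List Filling
  gen []            m = if does (full? m) then (λ _ _ → unp (+ 0)) ∷ [] else []
  gen ((t , u) ∷ E) m = gen E m ++
    (if does (addable? t (toℕ u) m) then putBoth t (m (toℕ u)) (toℕ u) (gen E (bump m (toℕ u))) else [])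

  val : Filling → ℕ → Fin n → ℤ
  val f i u = value i (toℕ u) (f i (toℕ u))

  -- Describes the part of a tableau that is still to be filled. Through `event` the order of the
  -- list bounds the values: if the list is sorted, every remaining entry comes after the events
  -- already read.
  record IsTableau (E : List (Event n)) (m : ℕ → ℕ) (f : Filling) : Set where
    constructor tableau
    field
      rows  : ∀ i u v → toℕ v ≡ suc (toℕ u) → Cell m i (toℕ u) → Cell m i (toℕ v) → val f i u ℤ.≤ val f i v
      cols  : ∀ i u → Cell m i (toℕ u) → Cell m (suc i) (toℕ u) → val f i u ℤ.< val f (suc i) u
      event : ∀ i u → Cell m i (toℕ u) → (val f i u , u) ∈ E
      fits  : ∀ i u → Cell m i (toℕ u) → Ok (val f i u) (pos i (toℕ u))

    cols-strict : ∀ {i i′} u → m (toℕ u) ℕ.≤ i → i ℕ.< i′ → i′ ℕ.< lam (toℕ u) → val f i u ℤ.< val f i′ u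
    cols-strict {i} {suc i′} u m≤i (s≤s i≤i′) i′< with ℕP.m≤n⇒m<n∨m≡n i≤i′
    ... | inj₂ ≡.refl = cols i u (m≤i , ℕP.<⇒≤ i′<) (ℕP.m≤n⇒m≤1+n m≤i , i′<)
    ... | inj₁ i<i′   = ℤP.<-trans (cols-strict u m≤i i<i′ (ℕP.<⇒≤ i′<))
          (cols i′ u (ℕP.≤-trans m≤i i≤i′ , ℕP.<⇒≤ i′<) (ℕP.m≤n⇒m≤1+n (ℕP.≤-trans m≤i i≤i′) , i′<))

  weaken : ∀ {e E m f} → IsTableau E m f → IsTableau (e ∷ E) m f
  weaken s = tableau rows cols (λ i u c → there (event i u c)) fits
    where open IsTableau s

  Top : (ℕ → ℕ) → ℕ → ℕ → ℕ → Set
  Top m j₀ i j = i ≡ m j₀ × j ≡ j₀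

  bump-cell⇒cell : ∀ m j₀ {i j} → Cell (bump m j₀) i j → Cell m i j
  bump-cell⇒cell m j₀ {i} {j} (h , h′) = ℕP.≤-trans (bump-≥ m j₀ j) h , h′

  bump-cell⇒¬top : ∀ m j₀ {i j} → Cell (bump m j₀) i j → ¬ Top m j₀ i j
  bump-cell⇒¬top m j₀ (h , _) (≡.refl , ≡.refl) rewrite bump-at m j₀ = ℕP.<-irrefl ≡.refl h

  cell-split : ∀ m j₀ {i j} → Cell m i j → Top m j₀ i j ⊎ Cell (bump m j₀) i j
  cell-split m j₀ {i} {j} (h , h′) with j ℕ.≟ j₀
  ... | no j≢j₀ = inj₂ (≡.subst (ℕ._≤ i) (≡.sym (bump-≢ m j≢j₀)) h , h′)
  ... | yes ≡.refl with ℕP.m≤n⇒m<n∨m≡n h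
  ...   | inj₁ m<i = inj₂ (≡.subst (ℕ._≤ i) (≡.sym (bump-at m j)) m<i , h′)
  ...   | inj₂ m≡i = inj₁ (≡.sym m≡i , ≡.refl)

  put-tableau : ∀ {t u₀ m E e f} → Addable t (toℕ u₀) m → value (m (toℕ u₀)) (toℕ u₀) e ≡ t →
    All ((t , u₀) ≺_) E → IsTableau E (bump m (toℕ u₀)) f →
    IsTableau ((t , u₀) ∷ E) m (put (m (toℕ u₀)) (toℕ u₀) e f)
  put-tableau {t} {u₀} {m} {E} {e} {f} add e≡t E> s = tableau rows′ cols′ event′ fits′
    where
    open IsTableau s
    j₀ : ℕ
    j₀ = toℕ u₀
    g : Filling
    g = put (m j₀) j₀ e f
    at-top : ∀ {i u} → Top m j₀ i (toℕ u) → val g i u ≡ t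
    at-top {u = u} (≡.refl , q) rewrite q = ≡.trans (≡.cong (value (m j₀) j₀) (put-at (m j₀) j₀ e f)) e≡t
    off-top : ∀ {i u} → Cell (bump m j₀) i (toℕ u) → val g i u ≡ val f i u
    off-top {i} {u} c = ≡.cong (value i (toℕ u)) (put-≢ e f (bump-cell⇒¬top m j₀ c))
    later : ∀ {i u} → Cell (bump m j₀) i (toℕ u) → (t , u₀) ≺ (val f i u , u)
    later c = All.lookup E> (event _ _ c)
    rows′ : ∀ i u v → toℕ v ≡ suc (toℕ u) → Cell m i (toℕ u) → Cell m i (toℕ v) → val g i u ℤ.≤ val g i v
    rows′ i u v adj cu cv with cell-split m j₀ cu | cell-split m j₀ cv
    ... | inj₁ (_ , q) | inj₁ (_ , q′) = contradiction (≡.trans (≡.sym adj) (≡.trans q′ (≡.sym q))) ℕP.1+n≢n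
    ... | inj₁ top     | inj₂ c′ = ≡.subst₂ ℤ._≤_ (≡.sym (at-top {u = u} top)) (≡.sym (off-top {u = v} c′)) (≺⇒≤ (later c′))
    -- `FreeLeft` says that the left neighbour of the new cell is already filled, so it is not among
    -- the remaining cells.
    ... | inj₂ c       | inj₁ (≡.refl , q) =
      contradiction (proj₁ cu) (ℕP.<⇒≱ (proj₂ (proj₂ add) (toℕ u) (≡.trans (≡.sym q) adj)))
    ... | inj₂ c       | inj₂ c′ = ≡.subst₂ ℤ._≤_ (≡.sym (off-top {u = u} c)) (≡.sym (off-top {u = v} c′)) (rows i u v adj c c′)
    cols′ : ∀ i u → Cell m i (toℕ u) → Cell m (suc i) (toℕ u) → val g i u ℤ.< val g (suc i) u
    cols′ i u c⁰ c¹ with cell-split m j₀ c⁰ | cell-split m j₀ c¹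
    ... | inj₁ (p , _) | inj₁ (p′ , _) = contradiction (≡.trans p′ (≡.sym p)) ℕP.1+n≢n
    ... | inj₁ top@(_ , q) | inj₂ c′ with ≡.refl ← FinP.toℕ-injective q =
      ≡.subst₂ ℤ._<_ (≡.sym (at-top {u = u} top)) (≡.sym (off-top {u = u} c′)) (≺⇒< (later c′))
    ... | inj₂ c | inj₁ (p , q) = contradiction (proj₁ c⁰)
      (ℕP.<⇒≱ (≡.subst (i ℕ.<_) (≡.trans p (≡.cong m (≡.sym q))) ℕP.≤-refl))
    ... | inj₂ c | inj₂ c′ = ≡.subst₂ ℤ._<_ (≡.sym (off-top {u = u} c)) (≡.sym (off-top {u = u} c′)) (cols i u c c′)
    event′ : ∀ i u → Cell m i (toℕ u) → (val g i u , u) ∈ (t , u₀) ∷ E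
    event′ i u c⁰ with cell-split m j₀ c⁰
    ... | inj₁ top@(_ , q) = here (≡.cong₂ _,_ (at-top {u = u} top) (FinP.toℕ-injective q))
    ... | inj₂ c = there (≡.subst (λ s → (s , u) ∈ E) (≡.sym (off-top {u = u} c)) (event i u c))
    fits′ : ∀ i u → Cell m i (toℕ u) → Ok (val g i u) (pos i (toℕ u))
    fits′ i u c⁰ with cell-split m j₀ c⁰
    ... | inj₁ top@(p , q) = ≡.subst₂ Ok (≡.sym (at-top {u = u} top)) (≡.cong₂ pos (≡.sym p) (≡.sym q)) (proj₁ add)
    ... | inj₂ c = ≡.subst (λ s → Ok s _) (≡.sym (off-top {u = u} c)) (fits i u c)

  Sorted : List (Event n) → Set
  Sorted = AllPairs _≺_

  gen-sound : ∀ E m → Sorted E → All (IsTableau E m) (gen E m)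
  gen-sound [] m [] with full? m
  ... | yes full = tableau (λ i u _ _ c _ → absurd c) (λ i u c _ → absurd c) (λ i u c → absurd c) (λ i u c → absurd c) ∷ []
    where
    absurd : ∀ {i u} {A : Set} → Cell m i (toℕ u) → A
    absurd {u = u} (h , h′) = contradiction h (ℕP.<⇒≱ (≡.subst (_ ℕ.<_) (≡.sym (full u)) h′))
  ... | no _ = []
  gen-sound ((t , u) ∷ E) m (E> ∷ sorted) = AllP.++⁺ (All.map weaken (gen-sound E m sorted)) added
    where
    added : All (IsTableau ((t , u) ∷ E) m)
      (if does (addable? t (toℕ u) m) then putBoth t (m (toℕ u)) (toℕ u) (gen E (bump m (toℕ u))) else [])
    added with addable? t (toℕ u) m
    ... | no _ = []
    ... | yes add = AllP.++⁺
      (AllP.map⁺ (All.map (put-tableau add ≡.refl E>) (gen-sound E (bump m (toℕ u)) sorted)))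
      (AllP.map⁺ (All.map (put-tableau add (value-primed t (m (toℕ u)) (toℕ u)) E>) (gen-sound E (bump m (toℕ u)) sorted)))

  Agree : (ℕ → ℕ) → Filling → Filling → Set
  Agree m f g = ∀ i (u : Fin n) → Cell m i (toℕ u) → f i (toℕ u) ≡ g i (toℕ u)

  -- The difference is witnessed inside the shape, since fillings take irrelevant values elsewhere;
  -- it therefore survives the passage to lists of rows.
  Apart : (ℕ → ℕ) → Filling → Filling → Set
  Apart m f g = ∃ λ i → Σ[ u ∈ Fin n ] Cell m i (toℕ u) × f i (toℕ u) ≢ g i (toℕ u)

  put-apart : ∀ {m f g} (u : Fin n) e → Apart (bump m (toℕ u)) f g →
    Apart m (put (m (toℕ u)) (toℕ u) e f) (put (m (toℕ u)) (toℕ u) e g)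
  put-apart {m} {f} {g} u e (i , v , c , f≢g) = i , v , bump-cell⇒cell m (toℕ u) c ,
    λ eq → f≢g (≡.trans (≡.sym (put-≢ e f (bump-cell⇒¬top m (toℕ u) c))) (≡.trans eq (put-≢ e g (bump-cell⇒¬top m (toℕ u) c))))

  -- Whether an event is used shows in the top cell of its column: a filling that ignores `(t , u)`
  -- has a value later than `t` there. The two ways of using the event differ by the prime.
  gen-apart : ∀ E m → Sorted E → AllPairs (Apart m) (gen E m)
  gen-apart [] m [] with full? m
  ... | yes _ = [] ∷ []
  ... | no _  = []
  gen-apart ((t , u) ∷ E) m (E> ∷ sorted) with addable? t (toℕ u) m
  ... | no _ = AllPairsP.++⁺ (gen-apart E m sorted) [] (All.universal (λ _ → []) _)
  ... | yes (_ , m<lam , _) = AllPairsP.++⁺ (gen-apart E m sorted)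
    (AllPairsP.++⁺ (half (unp t)) (half (primed t i j))
      (AllP.map⁺ (All.universal (λ f → AllP.map⁺ (All.universal (λ g →
        i , u , c , λ eq → unprimed≢primed (≡.trans (≡.sym (put-at i j _ f)) (≡.trans eq (put-at i j _ g)))) _)) _)))
    (All.map (λ s → AllP.++⁺ (apart-from s ≡.refl) (apart-from s (value-primed t i j))) (gen-sound E m sorted))
    where
    j i : ℕ
    j = toℕ u
    i = m j
    c : Cell m i j
    c = ℕP.≤-refl , m<lam
    unprimed≢primed : unp t ≢ primed t i j
    unprimed≢primed ()
    half : ∀ e → AllPairs (Apart m) (map (put i j e) (gen E (bump m j)))
    half e = AllPairsP.map⁺ (AllPairs.map (λ {f} {g} → put-apart {m} {f} {g} u e) (gen-apart E (bump m j) sorted))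
    separate : ∀ {f e} → IsTableau E m f → value i j e ≡ t → ∀ g → Apart m f (put i j e g)
    separate {f} {e} s e≡t g = i , u , c , λ eq → ℤP.<-irrefl
      (≡.sym (≡.trans (≡.cong (value i j) (≡.trans eq (put-at i j e g))) e≡t))
      (≺⇒< (All.lookup E> (IsTableau.event s i u c)))
    apart-from : ∀ {f e} → IsTableau E m f → value i j e ≡ t →
      All (Apart m f) (map (put i j e) (gen E (bump m j)))
    apart-from s e≡t = AllP.map⁺ (All.universal (separate s e≡t) _)

  module _ (lam-decreasing : Decreasing lam) where

    -- If the left neighbour of the top cell were unfilled, the row condition would make its value
    -- at most `t`. But its event comes after `(t , u)` and belongs to an earlier column, so its
    -- value exceeds `t`. The neighbour lies in the shape by `lam-decreasing`.
    tableau-addable : ∀ {t u E m f} → All ((t , u) ≺_) E → IsTableau ((t , u) ∷ E) m f →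
      m (toℕ u) ℕ.< lam (toℕ u) → val f (m (toℕ u)) u ≡ t → Addable t (toℕ u) m
    tableau-addable {t} {u} {E} {m} {f} E> s m<lam ≡t =
      ≡.subst (λ s → Ok s _) ≡t (fits _ u (ℕP.≤-refl , m<lam)) , m<lam , left
      where
      open IsTableau s
      left : FreeLeft m (toℕ u)
      left k q with m (toℕ u) ℕ.<? m k
      ... | yes h = h
      ... | no h = contradiction (event _ v cv) absurd
        where
        v : Fin n
        v = fromℕ< (ℕP.≤-trans (ℕP.≤-reflexive (≡.sym q)) (ℕP.<⇒≤ (FinP.toℕ<n u)))
        v≡ : toℕ v ≡ k
        v≡ = FinP.toℕ-fromℕ< _
        adj : toℕ u ≡ suc (toℕ v)
        adj = ≡.trans q (≡.cong suc (≡.sym v≡))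
        cv : Cell m (m (toℕ u)) (toℕ v)
        cv = ≡.subst (λ k → m k ℕ.≤ m (toℕ u)) (≡.sym v≡) (ℕP.≮⇒≥ h) ,
             ℕP.≤-trans m<lam (antitone lam-decreasing (ℕP.≤-trans (ℕP.n≤1+n _) (ℕP.≤-reflexive (≡.sym adj))))
        ≤t : val f (m (toℕ u)) v ℤ.≤ t
        ≤t = ≡.subst (val f (m (toℕ u)) v ℤ.≤_) ≡t (rows _ v u adj cv (ℕP.≤-refl , m<lam))
        absurd : ¬ (val f (m (toℕ u)) v , v) ∈ (t , u) ∷ E
        absurd (here eq) = contradiction (≡.trans adj (≡.cong (suc ∘ toℕ ∘ proj₂) eq)) (λ h → ℕP.1+n≢n (≡.sym h))
        absurd (there v∈) with All.lookup E> v∈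
        ... | inj₁ t<     = ℤP.<⇒≱ t< ≤t
        ... | inj₂ (_ , u<v) = ℕP.<-asym u<v (≡.subst (suc (toℕ v) ℕ.≤_) (≡.sym adj) ℕP.≤-refl)

    tableau-take : ∀ {t u E m f} → IsTableau ((t , u) ∷ E) m f →
      val f (m (toℕ u)) u ≡ t → IsTableau E (bump m (toℕ u)) f
    tableau-take {t} {u} {E} {m} {f} s ≡t = tableau
      (λ i v v′ adj c c′ → rows i v v′ adj (bump-cell⇒cell m (toℕ u) c) (bump-cell⇒cell m (toℕ u) c′))
      (λ i v c c′ → cols i v (bump-cell⇒cell m (toℕ u) c) (bump-cell⇒cell m (toℕ u) c′))
      event′ (λ i v c → fits i v (bump-cell⇒cell m (toℕ u) c))
      where
      open IsTableau s
      event′ : ∀ i v → Cell (bump m (toℕ u)) i (toℕ v) → (val f i v , v) ∈ E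
      event′ i v c with event i v (bump-cell⇒cell m (toℕ u) c)
      ... | there v∈ = v∈
      ... | here eq with ≡.refl ← ≡.cong proj₂ eq = contradiction (≡.trans ≡t (≡.sym (≡.cong proj₁ eq)))
              (ℤP.<⇒≢ (cols-strict v ℕP.≤-refl (≡.subst (ℕ._≤ i) (bump-at m (toℕ v)) (proj₁ c)) (proj₂ c)))

    -- Were `t` the value of a lower cell of column `u`, the top cell would have a smaller value,
    -- while its event is one of the later events in `E`.
    tableau-skip : ∀ {t u E m f} → All ((t , u) ≺_) E → IsTableau ((t , u) ∷ E) m f →
      (m (toℕ u) ℕ.< lam (toℕ u) → val f (m (toℕ u)) u ≢ t) → IsTableau E m f
    tableau-skip {t} {u} {E} {m} {f} E> s ≢t = tableau rows cols event′ fits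
      where
      open IsTableau s
      event′ : ∀ i v → Cell m i (toℕ v) → (val f i v , v) ∈ E
      event′ i v c with event i v c
      ... | there v∈ = v∈
      ... | here eq with ≡.refl ← ≡.cong proj₂ eq with ℕP.m≤n⇒m<n∨m≡n (proj₁ c)
      ...   | inj₂ ≡.refl = contradiction (≡.cong proj₁ eq) (≢t (proj₂ c))
      ...   | inj₁ m<i with event _ v (ℕP.≤-refl , ℕP.<-trans m<i (proj₂ c))
      ...     | here eq′   = contradiction (≡.cong proj₁ eq′) (≢t (ℕP.<-trans m<i (proj₂ c)))
      ...     | there top∈ = contradiction (≺⇒< (All.lookup E> top∈))
                (ℤP.<-asym (≡.subst (val f (m (toℕ v)) v ℤ.<_) (≡.cong proj₁ eq) (cols-strict v ℕP.≤-refl m<i (proj₂ c))))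

    put-agree : ∀ {m f g} (u : Fin n) {e} → f (m (toℕ u)) (toℕ u) ≡ e → Agree (bump m (toℕ u)) f g →
      Agree m f (put (m (toℕ u)) (toℕ u) e g)
    put-agree {m} {f} {g} u {e} eq agree i v c with cell-split m (toℕ u) c
    ... | inj₁ (≡.refl , q) rewrite q = ≡.trans eq (≡.sym (put-at _ _ e g))
    ... | inj₂ c′ = ≡.trans (agree i v c′) (≡.sym (put-≢ e g (bump-cell⇒¬top m (toℕ u) c′)))

    gen-complete : ∀ E m {f} → Sorted E → (∀ k → m k ℕ.≤ lam k) → IsTableau E m f → Any (Agree m f) (gen E m)
    gen-complete [] m {f} [] m≤lam s with full? m
    ... | no ¬full = contradiction (λ u → ℕP.≤-antisym (m≤lam (toℕ u)) (ℕP.≮⇒≥ (λ m<lam →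
                       contradiction (IsTableau.event s _ u (ℕP.≤-refl , m<lam)) (λ ())))) ¬full
    ... | yes _ = here (λ i u c → contradiction (IsTableau.event s i u c) (λ ()))
    gen-complete ((t , u) ∷ E) m {f} (E> ∷ sorted) m≤lam s
      with (m (toℕ u) ℕ.<? lam (toℕ u)) ×-dec (val f (m (toℕ u)) u ℤ.≟ t)
    ... | no ¬take = AnyP.++⁺ˡ (gen-complete E m sorted m≤lam (tableau-skip E> s (λ p q → ¬take (p , q))))
    ... | yes (m<lam , ≡t) = AnyP.++⁺ʳ (gen E m) taken
      where
      j : ℕ
      j = toℕ u
      bump≤lam : ∀ k → bump m j k ℕ.≤ lam k
      bump≤lam k with eq? k j
      ... | yes ≡.refl = m<lam
      ... | no _       = m≤lam k
      rest : Any (Agree (bump m j) f) (gen E (bump m j))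
      rest = gen-complete E (bump m j) sorted bump≤lam (tableau-take s ≡t)
      taken : Any (Agree m f)
        (if does (addable? t j m) then putBoth t (m j) j (gen E (bump m j)) else [])
      taken with addable? t j m
      ... | no ¬add = contradiction (tableau-addable E> s m<lam ≡t) ¬add
      ... | yes _ with value-inverse (m j) j (f (m j) j) ≡t
      ...   | inj₁ eq = AnyP.++⁺ˡ (AnyP.map⁺ (Any.map (λ {g} → put-agree {m} {f} {g} u eq) rest))
      ...   | inj₂ eq = AnyP.++⁺ʳ _ (AnyP.map⁺ (Any.map (λ {g} → put-agree {m} {f} {g} u eq) rest))

-- Lattice paths

pos-suc : ∀ i j → pos (suc i) j ≡ ℤ.suc (pos i j)
pos-suc i j = ℤP.+-assoc (+ 1) (+ i) (ℤ.- + j)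

pos-suc-suc : ∀ i j → pos (suc i) (suc j) ≡ pos i j
pos-suc-suc i j = solveℤ 2 (λ i j → (K̂ (+ 1) ⊹ i) ⊟ (K̂ (+ 1) ⊹ j) ⊜ i ⊟ j) ≡.refl (+ i) (+ j)

pos-< : ∀ i j i′ j′ → i ℕ.+ j′ ℕ.< i′ ℕ.+ j → pos i j ℤ.< pos i′ j′
pos-< i j i′ j′ h = ≡.subst₂ ℤ._<_
  (solveℤ 3 (λ i j j′ → (i ⊹ j′) ⊹ (K̂ (+ 0) ⊟ j ⊟ j′) ⊜ i ⊟ j) ≡.refl (+ i) (+ j) (+ j′))
  (solveℤ 3 (λ i′ j j′ → (i′ ⊹ j) ⊹ (K̂ (+ 0) ⊟ j ⊟ j′) ⊜ i′ ⊟ j′) ≡.refl (+ i′) (+ j) (+ j′))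
  (ℤP.+-monoˡ-< (+ 0 ℤ.- + j ℤ.- + j′) (+<+ h))

pos-injectiveˡ : ∀ {i i′} j → pos i j ≡ pos i′ j → i ≡ i′
pos-injectiveˡ {i} {i′} j e = ℤP.+-injective
  (≡.trans (≡.sym (back i)) (≡.trans (≡.cong (λ p → p ℤ.+ + j) e) (back i′)))
  where
  back : ∀ i → pos i j ℤ.+ + j ≡ + i
  back i = solveℤ 2 (λ i j → i ⊟ j ⊹ j ⊜ i) ≡.refl (+ i) (+ j)

times : ∀ {n} → Fin n → List (Event n) → List ℤ
times v []            = []
times v ((t , u) ∷ E) = if does (v FinP.≟ u) then t ∷ times v E else times v E

times-at : ∀ {n} (u : Fin n) t E → times u ((t , u) ∷ E) ≡ t ∷ times u E
times-at u t E with u FinP.≟ u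
... | yes _  = ≡.refl
... | no u≢u = contradiction ≡.refl u≢u

times-≢ : ∀ {n} {u v : Fin n} t E → v ≢ u → times v ((t , u) ∷ E) ≡ times v E
times-≢ {u = u} {v} t E v≢u with v FinP.≟ u
... | yes v≡u = contradiction v≡u v≢u
... | no _    = ≡.refl

-- When `(t , u)` has been read, its left neighbour has already had its turn at time `t`, so both
-- columns face the same future times. Reading equal times from left to right provides this, and
-- `det-blocked` rests on it.
Orderly : ∀ {n} → List (Event n) → Set
Orderly []            = ⊤
Orderly ((t , u) ∷ E) = (∀ v → toℕ u ≡ suc (toℕ v) → times v E ≡ times u E) × Orderly E

module Paths {c ℓ : Level} (R : CommutativeRing c ℓ) (y z : ℤ → CommutativeRing.Carrier R)
             (κ : ℤ) (Ok : ℤ → ℤ → Set) (ok? : ∀ t p → Dec (Ok t p)) where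
  open CommutativeRing R hiding (zero; ring)
  open Relation.Binary.Reasoning.Setoid setoid

  abstract
    at? : (p q : ℤ) → Dec (p ≡ q)
    at? = ℤ._≟_

  weight : ℤ → ℤ → Carrier
  weight t p = if does (ok? t p) then y t - z (t ℤ.+ (κ ℤ.- p)) else 0#

  weight-ok : ∀ {t p} → Ok t p → weight t p ≡ y t - z (t ℤ.+ (κ ℤ.- p))
  weight-ok {t} {p} ok with ok? t p
  ... | yes _  = ≡.refl
  ... | no ¬ok = contradiction ok ¬ok

  weight-¬ok : ∀ {t p} → ¬ Ok t p → weight t p ≡ 0#
  weight-¬ok {t} {p} ¬ok with ok? t p
  ... | yes ok = contradiction ok ¬ok
  ... | no _   = ≡.refl

  path : List ℤ → ℤ → ℤ → Carrier
  path []       p q = if does (at? p q) then 1# else 0#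
  path (t ∷ ts) p q = path ts p q + weight t p * path ts (ℤ.suc p) q

  path-[]-≢ : ∀ {p q} → p ≢ q → path [] p q ≈ 0#
  path-[]-≢ {p} {q} p≢q with at? p q
  ... | yes p≡q = contradiction p≡q p≢q
  ... | no _    = refl

  path-beyond : ∀ ts {p q} → q ℤ.< p → path ts p q ≈ 0#
  path-beyond []       q<p = path-[]-≢ (λ p≡q → ℤP.<-irrefl (≡.sym p≡q) q<p)
  path-beyond (t ∷ ts) q<p = trans
    (+-cong (path-beyond ts q<p) (trans (*-congˡ (path-beyond ts (ℤP.<-≤-trans q<p (ℤP.i≤suc[i] _)))) (zeroʳ _)))
    (+-identityˡ 0#)

  path-diagonal : ∀ ts q → path ts q q ≈ 1#
  path-diagonal []       q with at? q q
  ... | yes _  = refl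
  ... | no q≢q = contradiction ≡.refl q≢q
  path-diagonal (t ∷ ts) q = trans
    (+-cong (path-diagonal ts q)
      (trans (*-congˡ (path-beyond ts (ℤP.suc[i]≤j⇒i<j ℤP.≤-refl))) (zeroʳ _)))
    (+-identityʳ 1#)

-- Finite products

module Products {c ℓ : Level} (R : CommutativeRing c ℓ) where
  open CommutativeRing R hiding (zero; ring)
  open Relation.Binary.Reasoning.Setoid setoid
  open Algebra.Solver.Ring.NaturalCoefficients.Default commutativeSemiring using (solve; _:=_; _:*_)

  prodN : ℕ → (ℕ → Carrier) → Carrier
  prodN zero    g = 1#
  prodN (suc k) g = g 0 * prodN k (g ∘ suc)

  prodN-cong : ∀ k {g h} → (∀ i → i ℕ.< k → g i ≈ h i) → prodN k g ≈ prodN k h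
  prodN-cong zero    e = refl
  prodN-cong (suc k) e = *-cong (e 0 (s≤s z≤n)) (prodN-cong k (λ i p → e (suc i) (s≤s p)))

  prodN-one : ∀ k {g} → (∀ i → i ℕ.< k → g i ≈ 1#) → prodN k g ≈ 1#
  prodN-one zero    e = refl
  prodN-one (suc k) e = trans (*-cong (e 0 (s≤s z≤n)) (prodN-one k (λ i p → e (suc i) (s≤s p)))) (*-identityˡ 1#)

  prodN-factor : ∀ k {g h} x {i₀} → i₀ ℕ.< k → g i₀ ≈ x * h i₀ → (∀ i → i ≢ i₀ → g i ≈ h i) →
    prodN k g ≈ x * prodN k h
  prodN-factor (suc k) x {zero} _ e₀ e = trans
    (*-cong e₀ (prodN-cong k (λ i _ → e (suc i) (λ ())))) (*-assoc _ _ _)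
  prodN-factor (suc k) x {suc i₀} (s≤s p) e₀ e = trans
    (*-cong (e 0 (λ ())) (prodN-factor k x p e₀ (λ i i≢ → e (suc i) (i≢ ∘ ℕP.suc-injective))))
    (solve 3 (λ a x b → a :* (x :* b) := x :* (a :* b)) refl _ x _)

  -- A row list holds only the cells of the shape, whereas `fillingWt` runs over a full row of a
  -- box; the factors 1 on both sides make up the difference.
  prodN-window : ∀ M L k {g h : ℕ → Carrier} → M ℕ.≤ L → L ℕ.≤ k → (∀ j → j ℕ.< M → h j ≈ 1#) →
    (∀ j → M ℕ.≤ j → j ℕ.< L → h j ≈ g j) → (∀ j → L ℕ.≤ j → h j ≈ 1#) →
    prodN (L ∸ M) (λ i → g (M ℕ.+ i)) ≈ prodN k h
  prodN-window zero zero k _ _ before inside after = sym (prodN-one k (λ j _ → after j z≤n))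
  prodN-window zero (suc L) (suc k) {g} M≤L (s≤s L≤k) before inside after =
    *-cong (sym (inside 0 z≤n (s≤s z≤n))) (prodN-window zero L k {g ∘ suc} z≤n L≤k (λ _ ())
      (λ j _ j<L → inside (suc j) z≤n (s≤s j<L)) (λ j L≤j → after (suc j) (s≤s L≤j)))
  prodN-window (suc M) (suc L) (suc k) {g} (s≤s M≤L) (s≤s L≤k) before inside after = begin
    _ ≈⟨ prodN-window M L k {g ∘ suc} M≤L L≤k (λ j j<M → before (suc j) (s≤s j<M))
           (λ j M≤j j<L → inside (suc j) (s≤s M≤j) (s≤s j<L)) (λ j L≤j → after (suc j) (s≤s L≤j)) ⟩
    _ ≈⟨ *-identityˡ _ ⟨
    _ ≈⟨ *-congʳ (before 0 (s≤s z≤n)) ⟨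
    _ ∎

-- Determinants of path generating functions as sums over tableaux

module NonIntersecting {c ℓ : Level} (R : CommutativeRing c ℓ) (y z : ℤ → CommutativeRing.Carrier R)
         (n : ℕ) (lam : ℕ → ℕ) (κ : ℤ) (Ok : ℤ → ℤ → Set) (ok? : ∀ t p → Dec (Ok t p))
         (height : ℕ) (lam≤height : ∀ k → lam k ℕ.≤ height) (lam-decreasing : Decreasing lam) where
  open CommutativeRing R hiding (zero; ring)
  open Alg R
  open Determinants R
  open Products R
  open Paths R y z κ Ok ok?
  open Generation n lam κ Ok ok?
  open Relation.Binary.Reasoning.Setoid setoid

  cellWt : (ℕ → ℕ) → Filling → ℕ → ℕ → Carrier
  cellWt m f i j = if does (cell? m i j) then wtE y z (f i j) else 1#

  cellWt-in : ∀ m f {i j} → Cell m i j → cellWt m f i j ≡ wtE y z (f i j)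
  cellWt-in m f {i} {j} c with cell? m i j
  ... | yes _ = ≡.refl
  ... | no ¬c = contradiction c ¬c

  cellWt-out : ∀ m f {i j} → ¬ Cell m i j → cellWt m f i j ≡ 1#
  cellWt-out m f {i} {j} ¬c with cell? m i j
  ... | yes c = contradiction c ¬c
  ... | no _  = ≡.refl

  -- The product is taken over a box independent of `m`, with factor 1 off the remaining cells, so
  -- that filling one cell changes a single factor.
  fillingWt : (ℕ → ℕ) → Filling → Carrier
  fillingWt m f = prodN height (λ i → prodN n (λ j → cellWt m f i j))

  total : (ℕ → ℕ) → List Filling → Carrier
  total m = foldr (λ f acc → fillingWt m f + acc) 0#

  fillingWt-put : ∀ m (u : Fin n) e f → m (toℕ u) ℕ.< lam (toℕ u) →
    fillingWt m (put (m (toℕ u)) (toℕ u) e f) ≈ wtE y z e * fillingWt (bump m (toℕ u)) f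
  fillingWt-put m u e f m<lam = prodN-factor height (wtE y z e) (ℕP.≤-trans m<lam (lam≤height j₀))
    (prodN-factor n (wtE y z e) (FinP.toℕ<n u) at-top (λ j j≢ → off-top (j≢ ∘ proj₂)))
    (λ i i≢ → prodN-cong n (λ j _ → off-top (i≢ ∘ proj₁)))
    where
    j₀ : ℕ
    j₀ = toℕ u
    g : Filling
    g = put (m j₀) j₀ e f
    at-top : cellWt m g (m j₀) j₀ ≈ wtE y z e * cellWt (bump m j₀) f (m j₀) j₀
    at-top = begin
      cellWt m g (m j₀) j₀ ≡⟨ ≡.trans (cellWt-in m g (ℕP.≤-refl , m<lam)) (≡.cong (wtE y z) (put-at _ _ e f)) ⟩
      wtE y z e            ≈⟨ *-identityʳ _ ⟨
      wtE y z e * 1#       ≡⟨ ≡.cong (wtE y z e *_) (cellWt-out (bump m j₀) f (λ c → bump-cell⇒¬top m j₀ c (≡.refl , ≡.refl))) ⟨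
      _ ∎
    off-top : ∀ {i j} → ¬ Top m j₀ i j → cellWt m g i j ≈ cellWt (bump m j₀) f i j
    off-top {i} {j} ¬top with cell? m i j
    ... | no ¬c = reflexive (≡.sym (cellWt-out (bump m j₀) f (¬c ∘ bump-cell⇒cell m j₀)))
    ... | yes c with cell-split m j₀ c
    ...   | inj₁ top = contradiction top ¬top
    ...   | inj₂ c′  = reflexive (≡.trans (≡.cong (wtE y z) (put-≢ e f ¬top)) (≡.sym (cellWt-in (bump m j₀) f c′)))

  total-++ : ∀ m fs gs → total m (fs ++ gs) ≈ total m fs + total m gs
  total-++ m []       gs = sym (+-identityˡ _)
  total-++ m (f ∷ fs) gs = trans (+-congˡ (total-++ m fs gs)) (sym (+-assoc _ _ _))

  total-put : ∀ m (u : Fin n) e fs → m (toℕ u) ℕ.< lam (toℕ u) →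
    total m (map (put (m (toℕ u)) (toℕ u) e) fs) ≈ wtE y z e * total (bump m (toℕ u)) fs
  total-put m u e []       m<lam = sym (zeroʳ _)
  total-put m u e (f ∷ fs) m<lam = trans
    (+-cong (fillingWt-put m u e f m<lam) (total-put m u e fs m<lam)) (sym (distribˡ _ _ _))

  total-putBoth : ∀ m (u : Fin n) t fs → m (toℕ u) ℕ.< lam (toℕ u) →
    total m (putBoth t (m (toℕ u)) (toℕ u) fs)
      ≈ (y t - z (t ℤ.+ (κ ℤ.- pos (m (toℕ u)) (toℕ u)))) * total (bump m (toℕ u)) fs
  total-putBoth m u t fs m<lam = begin
    _ ≈⟨ total-++ m (map (put (m (toℕ u)) (toℕ u) (unp t)) fs) _ ⟩
    _ ≈⟨ +-cong (total-put m u (unp t) fs m<lam) (total-put m u (primed t (m (toℕ u)) (toℕ u)) fs m<lam) ⟩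
    _ ≈⟨ distribʳ _ _ _ ⟨
    _ ∎

  end : Fin n → ℤ
  end i = pos (lam (toℕ i)) (toℕ i)

  matrix : List (Event n) → (ℕ → ℕ) → Fin n → Fin n → Carrier
  matrix E m i j = path (times j E) (pos (m (toℕ j)) (toℕ j)) (end i)

  det-step : ∀ t u E m → det n (matrix ((t , u) ∷ E) m)
    ≈ det n (matrix E m) + weight t (pos (m (toℕ u)) (toℕ u)) * det n (matrix E (bump m (toℕ u)))
  det-step t u E m = det-column-linear n (weight t (pos (m (toℕ u)) (toℕ u))) u here-column
    (λ i j j≢u → reflexive (≡.cong (λ ts → path ts (pos (m (toℕ j)) (toℕ j)) (end i)) (times-≢ t E j≢u)))
    (λ i j j≢u → reflexive (≡.cong₂ (λ ts h → path ts (pos h (toℕ j)) (end i))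
      (times-≢ t E j≢u) (≡.sym (bump-≢ m (j≢u ∘ FinP.toℕ-injective)))))
    where
    here-column : ∀ i → matrix ((t , u) ∷ E) m i u
      ≈ matrix E m i u + weight t (pos (m (toℕ u)) (toℕ u)) * matrix E (bump m (toℕ u)) i u
    here-column i rewrite times-at u t E | bump-at m (toℕ u) | pos-suc (m (toℕ u)) (toℕ u) = refl

  -- The paths of all columns up to `u` now start beyond the ends of all rows from `u` on: `j₀ + 1`
  -- columns, with only `j₀` rows outside the block.
  det-overfull : ∀ E m (u : Fin n) → Decreasing m → lam (toℕ u) ℕ.≤ m (toℕ u) →
    det n (matrix E (bump m (toℕ u))) ≈ 0#
  det-overfull E m u dec lam≤m = det-zero-block n j₀ (below (suc j₀))
    (λ i k j₀≤i k∈ → path-beyond (times k E) (pos-< (lam (toℕ i)) (toℕ i) (bump m j₀ (toℕ k)) (toℕ k)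
      (beyond i k j₀≤i (below⇒< (suc j₀) k k∈))))
    (count-below (suc j₀) n (FinP.toℕ<n u))
    where
    j₀ : ℕ
    j₀ = toℕ u
    beyond : ∀ (i k : Fin n) → j₀ ℕ.≤ toℕ i → toℕ k ℕ.< suc j₀ →
      lam (toℕ i) ℕ.+ toℕ k ℕ.< bump m j₀ (toℕ k) ℕ.+ toℕ i
    beyond i k j₀≤i (s≤s k≤j₀) with ℕP.m≤n⇒m<n∨m≡n k≤j₀
    -- Strictness comes from the added cell in column `j₀`, and from `k < j₀ ≤ i` in the columns to
    -- its left.
    ... | inj₂ k≡j₀ rewrite k≡j₀ | bump-at m j₀ =
      s≤s (ℕP.+-mono-≤ (ℕP.≤-trans (antitone lam-decreasing j₀≤i) lam≤m) j₀≤i)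
    ... | inj₁ k<j₀ rewrite bump-≢ m (ℕP.<⇒≢ k<j₀) =
      ℕP.+-mono-≤-< (ℕP.≤-trans (antitone lam-decreasing j₀≤i) (ℕP.≤-trans lam≤m (antitone dec k≤j₀)))
        (ℕP.<-≤-trans k<j₀ j₀≤i)

  -- The left neighbour has the same height, so the added cell moves the path of `u` onto the
  -- diagonal where the path of the neighbour stands. With equal future times the two columns of the
  -- matrix coincide.
  det-blocked : ∀ E m (u : Fin n) → Decreasing m →
    (∀ v → toℕ u ≡ suc (toℕ v) → times v E ≡ times u E) → ¬ FreeLeft m (toℕ u) →
    det n (matrix E (bump m (toℕ u))) ≈ 0#
  det-blocked E m u dec same ¬free with ¬freeLeft m (toℕ u) ¬free
  ... | k , q , mk≤mj = det-equal-columns n v u adj equal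
    where
    v : Fin n
    v = fromℕ< (ℕP.≤-trans (ℕP.≤-reflexive (≡.sym q)) (ℕP.<⇒≤ (FinP.toℕ<n u)))
    adj : toℕ u ≡ suc (toℕ v)
    adj = ≡.trans q (≡.cong suc (≡.sym (FinP.toℕ-fromℕ< _)))
    mv≡mu : m (toℕ v) ≡ m (toℕ u)
    mv≡mu = ℕP.≤-antisym (≡.subst (λ k → m k ℕ.≤ m (toℕ u)) (≡.sym (FinP.toℕ-fromℕ< _)) mk≤mj)
      (≡.subst (λ k → m k ℕ.≤ m (toℕ v)) (≡.sym adj) (dec (toℕ v)))
    equal : ∀ i → matrix E (bump m (toℕ u)) i v ≈ matrix E (bump m (toℕ u)) i u
    equal i = reflexive (≡.cong₂ (λ ts p → path ts p (end i)) (same v adj) same-position)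
      where
      same-position : pos (bump m (toℕ u) (toℕ v)) (toℕ v) ≡ pos (bump m (toℕ u) (toℕ u)) (toℕ u)
      same-position = ≡.trans (≡.cong (λ h → pos h (toℕ v))
          (≡.trans (bump-≢ m (λ e → ℕP.1+n≢n (≡.trans (≡.sym adj) (≡.sym e)))) mv≡mu))
        (≡.trans (≡.sym (pos-suc-suc (m (toℕ u)) (toℕ v)))
          (≡.cong₂ pos (≡.sym (bump-at m (toℕ u))) (≡.sym adj)))

  no-events-triangular : ∀ m → (∀ k → m k ℕ.≤ lam k) → LowerTriangular (matrix [] m)
  no-events-triangular m m≤lam i j i<j = path-[]-≢ (ℤP.<⇒≢
    (pos-< (m (toℕ j)) (toℕ j) (lam (toℕ i)) (toℕ i) (ℕP.+-mono-≤-<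
      (ℕP.≤-trans (m≤lam (toℕ j)) (antitone lam-decreasing (ℕP.<⇒≤ i<j))) i<j)))

  -- Without events a path must already be at its end, so the matrix is lower triangular, with
  -- diagonal entry 1 at the columns that are full and 0 at the others.
  det-no-events : ∀ m → (∀ k → m k ℕ.≤ lam k) → det n (matrix [] m) ≈ total m (gen [] m)
  det-no-events m m≤lam with full? m
  ... | yes full = begin
    det n (matrix [] m) ≈⟨ det-unitriangular n (no-events-triangular m m≤lam) (λ i → trans (reflexive
                             (≡.cong (λ h → path [] (pos h (toℕ i)) (end i)) (full i))) (path-diagonal [] (end i))) ⟩
    1#                  ≈⟨ prodN-one height (λ i _ → prodN-one n (λ j j<n →
                             reflexive (cellWt-out m (λ _ _ → unp (+ 0)) (empty j<n)))) ⟨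
    _                   ≈⟨ +-identityʳ _ ⟨
    _                   ∎
    where
    empty : ∀ {i j} → j ℕ.< n → ¬ Cell m i j
    empty {i} {j} j<n (h , h′) = ℕP.<⇒≱ h′ (≡.subst (ℕ._≤ i)
      (≡.subst (λ j → m j ≡ lam j) (FinP.toℕ-fromℕ< j<n) (full (fromℕ< j<n))) h)
  ... | no ¬full with FinP.¬∀⟶∃¬ n _ (λ u → m (toℕ u) ℕ.≟ lam (toℕ u)) ¬full
  ...   | u , m≢lam = det-triangular-zero n (no-events-triangular m m≤lam) u (path-[]-≢ (m≢lam ∘ pos-injectiveˡ (toℕ u)))

  det≈total : ∀ E m → Orderly E → Decreasing m → (∀ k → m k ℕ.≤ lam k) →
    det n (matrix E m) ≈ total m (gen E m)
  det≈total [] m _ dec m≤lam = det-no-events m m≤lam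
  det≈total ((t , u) ∷ E) m (same , orderly) dec m≤lam = begin
    det n (matrix ((t , u) ∷ E) m)       ≈⟨ det-step t u E m ⟩
    det n (matrix E m) + weight t p * det n (matrix E (bump m j))
                                         ≈⟨ +-cong (det≈total E m orderly dec m≤lam) moved ⟩
    total m (gen E m) + total m added    ≈⟨ total-++ m (gen E m) added ⟨
    total m (gen ((t , u) ∷ E) m)        ∎
    where
    j : ℕ
    j = toℕ u
    p : ℤ
    p = pos (m j) j
    added : List Filling
    added = if does (addable? t j m) then putBoth t (m j) j (gen E (bump m j)) else []
    moved : weight t p * det n (matrix E (bump m j)) ≈ total m added
    moved with addable? t j m
    ... | yes (ok , m<lam , free) = begin
      weight t p * det n (matrix E (bump m j))
        ≈⟨ *-cong (reflexive (weight-ok ok))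
             (det≈total E (bump m j) orderly (bump-decreasing dec free) bump≤lam) ⟩
      (y t - z (t ℤ.+ (κ ℤ.- p))) * total (bump m j) (gen E (bump m j))
        ≈⟨ total-putBoth m u t (gen E (bump m j)) m<lam ⟨
      _ ∎
      where
      bump≤lam : ∀ k → bump m j k ℕ.≤ lam k
      bump≤lam k with eq? k j
      ... | yes ≡.refl = m<lam
      ... | no _       = m≤lam k
    ... | no ¬add with ok? t p | m j ℕ.<? lam j | freeLeft? m j
    ...   | no ¬ok | _         | _        = zeroˡ _
    ...   | yes ok | no ¬m<lam | _        = trans (*-congˡ (det-overfull E m u dec (ℕP.≮⇒≥ ¬m<lam))) (zeroʳ _)
    ...   | yes ok | yes m<lam | no ¬free = trans (*-congˡ (det-blocked E m u dec same ¬free)) (zeroʳ _)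
    ...   | yes ok | yes m<lam | yes free = contradiction (ok , m<lam , free) ¬add

-- Flags

pos-strictly-antitone : ∀ {m} → Decreasing m → ∀ {i j} → i ℕ.< j → pos (m j) j ℤ.< pos (m i) i
pos-strictly-antitone {m} d {i} {j} i<j =
  pos-< (m j) j (m i) i (ℕP.+-mono-≤-< (antitone d (ℕP.<⇒≤ i<j)) i<j)

pos-antitone : ∀ {m} → Decreasing m → ∀ {i j} → i ℕ.≤ j → pos (m j) j ℤ.≤ pos (m i) i
pos-antitone d {i} i≤j with ℕP.m≤n⇒m<n∨m≡n i≤j
... | inj₁ i<j   = ℤP.<⇒≤ (pos-strictly-antitone d i<j)
... | inj₂ ≡.refl = ℤP.≤-refl

interval : ℤ → ℕ → List ℤ
interval t zero    = []
interval t (suc N) = t ∷ interval (ℤ.suc t) N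

module Flags (n : ℕ) (lam mu : ℕ → ℕ) (a b : ℕ → ℤ)
  (lam-decreasing : Decreasing lam) (mu-decreasing : Decreasing mu)
  (flags : ∀ s → suc s ℕ.< n → mu s ℕ.< lam (suc s) →
    (a s ℤ.- a (suc s) ℤ.≤ + mu s ℤ.- + mu (suc s) ℤ.+ + 1) ×
    (b s ℤ.- b (suc s) ℤ.≤ + lam s ℤ.- + lam (suc s) ℤ.+ + 1)) where

  start stop : ℕ → ℤ
  start q = pos (mu q) q
  stop  q = pos (lam q) q

  -- Up to the additive constant `κ` these are the conjugate flags, and t - p is likewise the index
  -- of z in the weight of a step. `pred` occurs because the last step of a path starts one before
  -- its end.
  α β : ℕ → ℤ
  α q = a q ℤ.- start q
  β q = b q ℤ.- ℤ.pred (stop q)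

  Through : ℕ → ℤ → Set
  Through q p = start q ℤ.≤ p × p ℤ.< stop q

  -- Column q has a cell on the diagonal p, and its flag a (resp. b) allows the value t there.
  -- On the cells of a tableau this is equivalent to the flag conditions; unlike these it does not mention
  -- the column of the cell, so that two paths in the same position have the same future weights.
  OkLower OkUpper Ok : ℤ → ℤ → Set
  OkLower t p = ∃ λ q → q ℕ.< n × Through q p × α q ℤ.≤ t ℤ.- p
  OkUpper t p = ∃ λ q → q ℕ.< n × Through q p × t ℤ.- p ℤ.≤ β q
  Ok t p = OkLower t p × OkUpper t p

  abstract
    ok? : ∀ t p → Dec (Ok t p)
    ok? t p = ℕP.anyUpTo? (λ q → through? q ×-dec (α q ℤ.≤? t ℤ.- p)) n
        ×-dec ℕP.anyUpTo? (λ q → through? q ×-dec (t ℤ.- p ℤ.≤? β q)) n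
      where
      through? : ∀ q → Dec (Through q p)
      through? q = (start q ℤ.≤? p) ×-dec (p ℤ.<? stop q)

  Chain : ℕ → ℕ → Set
  Chain i j = ∀ s → i ℕ.≤ s → s ℕ.< j → mu s ℕ.< lam (suc s)

  chain-through : ∀ {i j p} → start i ℤ.≤ p → p ℤ.< stop j → Chain i j
  chain-through {i} {j} {p} i≤p p<j s i≤s s<j = ℤP.drop‿+≤+ (≤-linear₂
    (ℤP.i<j⇒suc[i]≤j (ℤP.≤-<-trans (ℤP.≤-trans (pos-antitone mu-decreasing i≤s) i≤p)
      (ℤP.<-≤-trans p<j (pos-antitone lam-decreasing s<j))))
    -- One unit is to spare: a common diagonal even gives `mu s + 1 < lam (suc s)`.
    (+≤+ (z≤n {1}))
    (solveℤ 3 (λ m s l → l ⊟ (K̂ (+ 1) ⊹ m)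
       ⊜ (l ⊟ (K̂ (+ 1) ⊹ s)) ⊟ (K̂ (+ 1) ⊹ (m ⊟ s)) ⊹ (K̂ (+ 1) ⊟ K̂ (+ 0))) ≡.refl (+ mu s) (+ s) (+ lam (suc s))))

  chain-mono : ∀ (f : ℕ → ℤ) → (∀ s → suc s ℕ.< n → mu s ℕ.< lam (suc s) → f s ℤ.≤ f (suc s)) →
    ∀ {i j} → i ℕ.≤ j → j ℕ.< n → Chain i j → f i ℤ.≤ f j
  chain-mono f step {i} i≤j = go (ℕP.≤⇒≤′ i≤j)
    where
    go : ∀ {j} → i ℕ.≤′ j → j ℕ.< n → Chain i j → f i ℤ.≤ f j
    go ℕ.≤′-refl     j<n chain = ℤP.≤-refl
    go (ℕ.≤′-step h) j<n chain = ℤP.≤-trans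
      (go h (ℕP.<⇒≤ j<n) (λ s i≤s s<j → chain s i≤s (ℕP.m≤n⇒m≤1+n s<j)))
      (step _ j<n (chain _ (ℕP.≤′⇒≤ h) ℕP.≤-refl))

  α-mono : ∀ {i j} → i ℕ.≤ j → j ℕ.< n → Chain i j → α i ℤ.≤ α j
  α-mono = chain-mono α (λ s s<n linked → ≤-linear (proj₁ (flags s s<n linked))
    (solveℤ 5 (λ a a′ m m′ s → a′ ⊟ (m′ ⊟ (K̂ (+ 1) ⊹ s)) ⊟ (a ⊟ (m ⊟ s)) ⊜ m ⊟ m′ ⊹ K̂ (+ 1) ⊟ (a ⊟ a′)) ≡.refl
      (a s) (a (suc s)) (+ mu s) (+ mu (suc s)) (+ s)))

  β-mono : ∀ {i j} → i ℕ.≤ j → j ℕ.< n → Chain i j → β i ℤ.≤ β j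
  β-mono = chain-mono β (λ s s<n linked → ≤-linear (proj₂ (flags s s<n linked))
    (solveℤ 5 (λ b b′ m m′ s → b′ ⊟ (K̂ (ℤ.- + 1) ⊹ (m′ ⊟ (K̂ (+ 1) ⊹ s))) ⊟ (b ⊟ (K̂ (ℤ.- + 1) ⊹ (m ⊟ s)))
        ⊜ m ⊟ m′ ⊹ K̂ (+ 1) ⊟ (b ⊟ b′)) ≡.refl
      (b s) (b (suc s)) (+ lam s) (+ lam (suc s)) (+ s)))

  -- A column `q` through the starting diagonal of `j` satisfies `q ≥ j` and is linked to `j` by
  -- that diagonal. Its bound `α q` is therefore at least `α j`, and the existential condition gives
  -- back the flag of `j`.
  okLower-start : ∀ {t j} → j ℕ.< n → OkLower t (start j) → a j ℤ.≤ t
  okLower-start {t} {j} j<n (q , q<n , (q≤j , j<q) , αq≤) = ≤-linear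
    (ℤP.≤-trans (α-mono j≤q q<n (chain-through ℤP.≤-refl j<q)) αq≤)
    (solveℤ 3 (λ t a s → t ⊟ a ⊜ (t ⊟ s) ⊟ (a ⊟ s)) ≡.refl t (a j) (start j))
    where
    j≤q : j ℕ.≤ q
    j≤q = ℕP.≮⇒≥ (λ q<j → ℤP.<⇒≱ (pos-strictly-antitone mu-decreasing q<j) q≤j)

  okUpper-stop : ∀ {t p i} → i ℕ.< n → ℤ.suc p ≡ stop i → OkUpper t p → t ℤ.- p ℤ.≤ β i
  okUpper-stop {t} {p} {i} i<n p≡ (q , q<n , (q≤p , p<q) , ≤βq) =
    ℤP.≤-trans ≤βq (β-mono q≤i i<n (chain-through q≤p (ℤP.suc[i]≤j⇒i<j (ℤP.≤-reflexive p≡))))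
    where
    q≤i : q ℕ.≤ i
    q≤i = ℕP.≮⇒≥ (λ i<q → ℤP.<⇒≱ (pos-strictly-antitone lam-decreasing i<q)
      (≡.subst (ℤ._≤ stop q) p≡ (ℤP.i<j⇒suc[i]≤j p<q)))

  -- For linked neighbours `stop (suc s)` is at least `start s`, so the diagonals of consecutive
  -- columns leave no gap. Going down from `j`, the first column that ends beyond `p` also starts at
  -- or before `p`.
  find-through : ∀ {i j p} → i ℕ.≤ j → Chain i j → start j ℤ.≤ p → p ℤ.< stop i →
    ∃ λ q → i ℕ.≤ q × q ℕ.≤ j × Through q p
  find-through {i} {j} {p} i≤j = go (ℕP.≤⇒≤′ i≤j)
    where
    go : ∀ {j} → i ℕ.≤′ j → Chain i j → start j ℤ.≤ p → p ℤ.< stop i → ∃ λ q → i ℕ.≤ q × q ℕ.≤ j × Through q p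
    go ℕ.≤′-refl chain j≤p p<i = i , ℕP.≤-refl , ℕP.≤-refl , j≤p , p<i
    go {suc j} (ℕ.≤′-step h) chain j≤p p<i with p ℤ.<? stop (suc j)
    ... | yes p<j = suc j , ℕP.m≤n⇒m≤1+n (ℕP.≤′⇒≤ h) , ℕP.≤-refl , j≤p , p<j
    ... | no p≮j with go h (λ s i≤s s<j → chain s i≤s (ℕP.m≤n⇒m≤1+n s<j)) start≤p p<i
      where
      start≤p : start j ℤ.≤ p
      start≤p = ℤP.≤-trans (≤-linear (+≤+ (chain j (ℕP.≤′⇒≤ h) ℕP.≤-refl))
        (solveℤ 3 (λ m l j → l ⊟ (K̂ (+ 1) ⊹ j) ⊟ (m ⊟ j) ⊜ l ⊟ (K̂ (+ 1) ⊹ m)) ≡.refl (+ mu j) (+ lam (suc j)) (+ j)))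
        (ℤP.≮⇒≥ p≮j)
    ...   | q , i≤q , q≤j , through = q , i≤q , ℕP.m≤n⇒m≤1+n q≤j , through

  Linked : ℕ → ℕ → Set
  Linked i j = j ℕ.≤ i ⊎ (i ℕ.< j × Chain i j)

  -- For a path from column `j` to row `i` with `j ≤ i`, columns `j` and `i` both meet the diagonal;
  -- the first witnesses the lower bound and the second the upper one, which the separate witnesses
  -- in `Ok` permit. For `i < j` neither need meet it, and a column in between inherits both bounds
  -- by monotonicity.
  ok-inside : ∀ {i j t p} → i ℕ.< n → j ℕ.< n → Linked i j → start j ℤ.≤ p → p ℤ.< stop i →
    α j ℤ.≤ t ℤ.- p → t ℤ.- p ℤ.≤ β i → Ok t p
  ok-inside {i} {j} i<n j<n (inj₁ j≤i) j≤p p<i α≤ ≤β =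
    (j , j<n , (j≤p , ℤP.<-≤-trans p<i (pos-antitone lam-decreasing j≤i)) , α≤) ,
    (i , i<n , (ℤP.≤-trans (pos-antitone mu-decreasing j≤i) j≤p , p<i) , ≤β)
  ok-inside {i} {j} i<n j<n (inj₂ (i<j , chain)) j≤p p<i α≤ ≤β with find-through (ℕP.<⇒≤ i<j) chain j≤p p<i
  ... | q , i≤q , q≤j , through =
    (q , q<n , through , ℤP.≤-trans (α-mono q≤j j<n (λ s q≤s → chain s (ℕP.≤-trans i≤q q≤s))) α≤) ,
    (q , q<n , through , ℤP.≤-trans ≤β (β-mono i≤q q<n (λ s i≤s s<q → chain s i≤s (ℕP.<-≤-trans s<q q≤j))))
    where
    q<n : q ℕ.< n
    q<n = ℕP.≤-<-trans q≤j j<n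

  module Entries {c ℓ : Level} (R : CommutativeRing c ℓ) (y z : ℤ → CommutativeRing.Carrier R) (κ : ℤ) where
    open CommutativeRing R hiding (zero; ring)
    open Paths R y z κ Ok ok?
    open SuperElementary R
    open Relation.Binary.Reasoning.Setoid setoid hiding (start; stop)

    suc-suc-diff : ∀ t p → ℤ.suc t ℤ.- ℤ.suc p ≡ t ℤ.- p
    suc-suc-diff t p = solveℤ 2 (λ t p → (K̂ (+ 1) ⊹ t) ⊟ (K̂ (+ 1) ⊹ p) ⊜ t ⊟ p) ≡.refl t p

    suc-diff : ∀ t p → t ℤ.- p ℤ.≤ ℤ.suc t ℤ.- p
    suc-diff t p = ≤-linear (+≤+ (z≤n {1}))
      (solveℤ 2 (λ t p → (K̂ (+ 1) ⊹ t) ⊟ p ⊟ (t ⊟ p) ⊜ K̂ (+ 1) ⊟ K̂ (+ 0)) ≡.refl t p)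

    -- Lateness persists, since t - p never decreases, and the step into `stop i` then violates the
    -- upper bound.
    path-late : ∀ {i} → i ℕ.< n → ∀ N t {p} → p ℤ.< stop i → β i ℤ.< t ℤ.- p →
      path (interval t N) p (stop i) ≈ 0#
    path-late i<n zero    t p<i late = path-[]-≢ (ℤP.<⇒≢ p<i)
    path-late {i} i<n (suc N) t {p} p<i late = trans
      (+-cong (path-late i<n N (ℤ.suc t) p<i (ℤP.<-≤-trans late (suc-diff t p))) moved) (+-identityˡ 0#)
      where
      moved : weight t p * path (interval (ℤ.suc t) N) (ℤ.suc p) (stop i) ≈ 0#
      moved with ℤ.suc p ℤ.≟ stop i
      ... | yes p≡ = trans (*-congʳ (reflexive (weight-¬ok
              (λ (_ , hi) → ℤP.<⇒≱ late (okUpper-stop {t} i<n p≡ hi))))) (zeroˡ _)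
      ... | no p≢ = trans (*-congˡ (path-late i<n N (ℤ.suc t) (ℤP.≤∧≢⇒< (ℤP.i<j⇒suc[i]≤j p<i) p≢)
              (≡.subst (β i ℤ.<_) (≡.sym (suc-suc-diff t p)) late))) (zeroʳ _)

    -- All paths run through one common time window, as equal columns require, instead of starting
    -- at their flags; steps before time `a j` are excluded by weight 0.
    path-wait : ∀ {j} → j ℕ.< n → ∀ d N {t} q → t ℤ.+ + d ≡ a j →
      path (interval t (d ℕ.+ N)) (start j) q ≈ path (interval (a j) N) (start j) q
    path-wait j<n zero N {t} q e =
      reflexive (≡.cong (λ t → path (interval t N) _ q) (≡.trans (≡.sym (ℤP.+-identityʳ t)) e))
    path-wait {j} j<n (suc d) N {t} q e = begin
      _ ≈⟨ +-congˡ (trans (*-congʳ (reflexive (weight-¬ok (λ (lo , _) → ℤP.<⇒≱ t<a (okLower-start j<n lo))))) (zeroˡ _)) ⟩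
      _ ≈⟨ +-identityʳ _ ⟩
      _ ≈⟨ path-wait j<n d N q (≡.trans (solveℤ 2 (λ t d → (K̂ (+ 1) ⊹ t) ⊹ d ⊜ t ⊹ (K̂ (+ 1) ⊹ d)) ≡.refl t (+ d)) e) ⟩
      _ ∎
      where
      t<a : t ℤ.< a j
      t<a = ℤP.suc[i]≤j⇒i<j (≡.subst (ℤ.suc t ℤ.≤_) e (≤-linear (+≤+ (z≤n {d}))
        (solveℤ 2 (λ t d → t ⊹ (K̂ (+ 1) ⊹ d) ⊟ (K̂ (+ 1) ⊹ t) ⊜ d ⊟ K̂ (+ 0)) ≡.refl t (+ d))))

    module _ {i j} (i<n : i ℕ.< n) (j<n : j ℕ.< n) (linked : Linked i j) where
      open Entry y z κ (stop i) (b i)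

      -- Both sides obey the recursion of `entry-step` while early and vanish once late. As the
      -- window reaches beyond `b i`, time cannot run out while early.
      path≈entry : ∀ N t {p} → b i ℤ.< t ℤ.+ + N → start j ℤ.≤ p → α j ℤ.≤ t ℤ.- p →
        path (interval t N) p (stop i) ≈ entry t p
      path≈entry N t {p} b< j≤p α≤ with ℤP.<-cmp p (stop i)
      ... | tri> _ _ i<p = trans (path-beyond (interval t N) i<p) (sym (entry-beyond t i<p))
      ... | tri≈ _ ≡.refl _ = trans (path-diagonal (interval t N) p) (sym (entry-diagonal t))
      ... | tri< p<i _ _ with t ℤ.- p ℤ.≤? β i
      ...   | no late = trans (path-late i<n N t p<i (ℤP.≰⇒> late)) (sym (entry-late t p<i (ℤP.≰⇒> late)))
      ...   | yes early = continue N b<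
        where
        t≤b : t ℤ.≤ b i
        t≤b = ≤-linear₂ early (ℤP.i<j⇒suc[i]≤j p<i) (solveℤ 4 (λ t p b q → b ⊟ t
          ⊜ (b ⊟ (K̂ (ℤ.- + 1) ⊹ q)) ⊟ (t ⊟ p) ⊹ (q ⊟ (K̂ (+ 1) ⊹ p))) ≡.refl t p (b i) (stop i))
        continue : ∀ N → b i ℤ.< t ℤ.+ + N → path (interval t N) p (stop i) ≈ entry t p
        continue zero    b< = contradiction t≤b (ℤP.<⇒≱ (≡.subst (b i ℤ.<_) (ℤP.+-identityʳ t) b<))
        continue (suc N) b< = begin
          path (interval (ℤ.suc t) N) p (stop i) + weight t p * path (interval (ℤ.suc t) N) (ℤ.suc p) (stop i)
            ≈⟨ +-cong (path≈entry N (ℤ.suc t) b<′ j≤p (ℤP.≤-trans α≤ (suc-diff t p)))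
                 (*-cong (reflexive (weight-ok (ok-inside {t = t} i<n j<n linked j≤p p<i α≤ early)))
                   (path≈entry N (ℤ.suc t) b<′ (ℤP.i≤j⇒i≤1+j j≤p)
                     (≡.subst (α j ℤ.≤_) (≡.sym (suc-suc-diff t p)) α≤))) ⟩
          _ ≈⟨ entry-step t p<i early ⟨
          entry t p ∎
          where
          b<′ : b i ℤ.< ℤ.suc t ℤ.+ + N
          b<′ = ≡.subst (b i ℤ.<_) (solveℤ 2 (λ t N → t ⊹ (K̂ (+ 1) ⊹ N) ⊜ (K̂ (+ 1) ⊹ t) ⊹ N) ≡.refl t (+ N)) b<

      path-from-start : ∀ {lo} d N → lo ℤ.+ + d ≡ a j → b i ℤ.< lo ℤ.+ + (d ℕ.+ N) →
        path (interval lo (d ℕ.+ N)) (start j) (stop i) ≈ entry (a j) (start j)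
      path-from-start {lo} d N e b< = trans (path-wait j<n d N (stop i) e)
        (path≈entry N (a j) (≡.subst (b i ℤ.<_) (≡.trans (≡.sym (ℤP.+-assoc lo (+ d) (+ N))) (≡.cong (λ t → t ℤ.+ + N) e)) b<)
          ℤP.≤-refl ℤP.≤-refl)

-- Events, conjugate partitions and row lists

module _ {n : ℕ} where

  events : ℤ → ℕ → List (Event n)
  events t zero    = []
  events t (suc N) = map (t ,_) (allFin n) ++ events (ℤ.suc t) N

  Increasing : List (Fin n) → Set
  Increasing = AllPairs (λ u v → toℕ u ℕ.< toℕ v)

  allFin-increasing : Increasing (allFin n)
  allFin-increasing = AllPairsP.tabulate⁺-< id

  times-skip : ∀ {v : Fin n} t us E → All (v ≢_) us → times v (map (t ,_) us ++ E) ≡ times v E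
  times-skip t []       E []         = ≡.refl
  times-skip t (u ∷ us) E (v≢u ∷ v∉) = ≡.trans (times-≢ t (map (t ,_) us ++ E) v≢u) (times-skip t us E v∉)

  times-once : ∀ {v : Fin n} t us E → Increasing us → v ∈ us → times v (map (t ,_) us ++ E) ≡ t ∷ times v E
  times-once t (u ∷ us) E (u< ∷ _) (here ≡.refl) = ≡.trans (times-at u t (map (t ,_) us ++ E))
    (≡.cong (t ∷_) (times-skip t us E (All.map (λ u<v u≡v → ℕP.<⇒≢ u<v (≡.cong toℕ u≡v)) u<)))
  times-once t (u ∷ us) E (u< ∷ inc) (there v∈) = ≡.trans
    (times-≢ t (map (t ,_) us ++ E) (λ v≡u → ℕP.<⇒≢ (All.lookup u< v∈) (≡.cong toℕ (≡.sym v≡u))))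
    (times-once t us E inc v∈)

  times-events : ∀ v t N → times v (events t N) ≡ interval t N
  times-events v t zero    = ≡.refl
  times-events v t (suc N) = ≡.trans (times-once t (allFin n) _ allFin-increasing (∈-allFin v))
    (≡.cong (t ∷_) (times-events v (ℤ.suc t) N))

  row-orderly : ∀ t us E → Increasing us → (∀ (u v : Fin n) → times u E ≡ times v E) → Orderly E →
    Orderly (map (t ,_) us ++ E)
  row-orderly t []       E _          same orderly = orderly
  row-orderly t (u ∷ us) E (u< ∷ inc) same orderly =
    (λ v adj → ≡.trans
      (times-skip t us E (All.map (λ u<w v≡w → ℕP.<⇒≢ (ℕP.<-trans (≡.subst (toℕ v ℕ.<_) (≡.sym adj) ℕP.≤-refl) u<w)
        (≡.cong toℕ v≡w)) u<))
      (≡.trans (same v u) (≡.sym (times-skip t us E (All.map (λ u<w u≡w → ℕP.<⇒≢ u<w (≡.cong toℕ u≡w)) u<))))) ,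
    row-orderly t us E inc same orderly

  events-orderly : ∀ t N → Orderly (events t N)
  events-orderly t zero    = tt
  events-orderly t (suc N) = row-orderly t (allFin n) (events (ℤ.suc t) N) allFin-increasing
    (λ u v → ≡.trans (times-events u (ℤ.suc t) N) (≡.sym (times-events v (ℤ.suc t) N)))
    (events-orderly (ℤ.suc t) N)

  events-≥ : ∀ t N → All (λ e → t ℤ.≤ proj₁ e) (events t N)
  events-≥ t zero    = []
  events-≥ t (suc N) = AllP.++⁺ (AllP.map⁺ (All.universal (λ _ → ℤP.≤-refl) (allFin n)))
    (All.map (ℤP.≤-trans (ℤP.i≤suc[i] t)) (events-≥ (ℤ.suc t) N))

  events-sorted : ∀ t N → AllPairs _≺_ (events t N)
  events-sorted t zero    = []
  events-sorted t (suc N) = AllPairsP.++⁺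
    (AllPairsP.map⁺ (AllPairs.map (λ u<v → inj₂ (≡.refl , u<v)) allFin-increasing))
    (events-sorted (ℤ.suc t) N)
    (AllP.map⁺ (All.universal (λ _ → All.map (inj₁ ∘ ℤP.suc[i]≤j⇒i<j) (events-≥ (ℤ.suc t) N)) (allFin n)))

  ∈-events : ∀ {s} t N (u : Fin n) → t ℤ.≤ s → s ℤ.< t ℤ.+ + N → (s , u) ∈ events t N
  ∈-events {s} t zero    u t≤s s< = contradiction t≤s (ℤP.<⇒≱ (≡.subst (s ℤ.<_) (ℤP.+-identityʳ t) s<))
  ∈-events {s} t (suc N) u t≤s s< with t ℤ.≟ s
  ... | yes ≡.refl = ∈-++⁺ˡ (∈-map⁺ (t ,_) (∈-allFin u))
  ... | no t≢s = ∈-++⁺ʳ _ (∈-events (ℤ.suc t) N u (ℤP.i<j⇒suc[i]≤j (ℤP.≤∧≢⇒< t≤s t≢s))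
    (≡.subst (s ℤ.<_) (solveℤ 2 (λ t N → t ⊹ (K̂ (+ 1) ⊹ N) ⊜ (K̂ (+ 1) ⊹ t) ⊹ N) ≡.refl t (+ N)) s<))

IsPartition-tail : ∀ {x xs} → IsPartition (x ∷ xs) → IsPartition xs
IsPartition-tail p i = p (suc i)

part-≤-part₁ : ∀ p → IsPartition p → ∀ i → part p (suc i) ℕ.≤ part p 1
part-≤-part₁ p isP zero    = ℕP.≤-refl
part-≤-part₁ p isP (suc i) = ℕP.≤-trans (isP i) (part-≤-part₁ p isP i)

part-beyond : ∀ p {i} → length p ℕ.≤ i → part p (suc i) ≡ 0
part-beyond []       h       = ≡.refl
part-beyond (x ∷ xs) {suc i} (s≤s h) = part-beyond xs h

part-zero : ∀ p → part p 0 ≡ 0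
part-zero []      = ≡.refl
part-zero (_ ∷ _) = ≡.refl

conj-accept : ∀ {x} xs {j} → j ℕ.≤ x → conj (x ∷ xs) j ≡ suc (conj xs j)
conj-accept xs {j} h = ≡.cong length (ListP.filter-accept (j ℕ.≤?_) h)

conj-reject : ∀ {x} xs {j} → ¬ j ℕ.≤ x → conj (x ∷ xs) j ≡ conj xs j
conj-reject xs {j} h = ≡.cong length (ListP.filter-reject (j ℕ.≤?_) h)

mutual
  -- Together with its converse below, this is the Galois connection between a partition and its
  -- conjugate; it translates row descriptions of cells into column descriptions.
  part⇒conj : ∀ p → IsPartition p → ∀ i j → suc j ℕ.≤ part p (suc i) → i ℕ.< conj p (suc j)
  part⇒conj (x ∷ xs) isP i j h with suc j ℕ.≤? x
  ... | no ¬j≤x = contradiction (ℕP.≤-trans h (part-≤-part₁ (x ∷ xs) isP i)) ¬j≤x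
  part⇒conj (x ∷ xs) isP zero j h | yes j≤x rewrite conj-accept xs j≤x = s≤s z≤n
  part⇒conj (x ∷ xs) isP (suc i) j h | yes j≤x rewrite conj-accept xs j≤x =
    s≤s (part⇒conj xs (IsPartition-tail {x} {xs} isP) i j h)

  conj⇒part : ∀ p → IsPartition p → ∀ i j → i ℕ.< conj p (suc j) → suc j ℕ.≤ part p (suc i)
  conj⇒part (x ∷ xs) isP i j h with suc j ℕ.≤? x
  ... | no ¬j≤x = contradiction (ℕP.≤-trans (conj⇒part xs (IsPartition-tail {x} {xs} isP) 0 j
          (ℕP.≤-trans (s≤s z≤n) (≡.subst (i ℕ.<_) (conj-reject xs ¬j≤x) h))) (isP 0)) ¬j≤x
  conj⇒part (x ∷ xs) isP zero j h | yes j≤x = j≤x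
  conj⇒part (x ∷ xs) isP (suc i) j h | yes j≤x =
    conj⇒part xs (IsPartition-tail {x} {xs} isP) i j (ℕP.≤-pred (≡.subst (suc i ℕ.<_) (conj-accept xs j≤x) h))

conj-decreasing : ∀ p → IsPartition p → Decreasing (conj p ∘ suc)
conj-decreasing p isP j = ℕP.≮⇒≥ (λ h → ℕP.<-irrefl ≡.refl
  (part⇒conj p isP (conj p (suc j)) j (ℕP.≤-trans (ℕP.n≤1+n _) (conj⇒part p isP (conj p (suc j)) (suc j) h))))

conj-monotone : ∀ mu la → IsPartition mu → IsPartition la → Contained mu la →
  ∀ j → conj mu (suc j) ℕ.≤ conj la (suc j)
conj-monotone mu la pm pl sub j = ℕP.≮⇒≥ (λ h → ℕP.<-irrefl ≡.refl
  (part⇒conj la pl (conj la (suc j)) j (ℕP.≤-trans (conj⇒part mu pm (conj la (suc j)) j h) (sub _))))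

conj-≤-length : ∀ p j → conj p j ℕ.≤ length p
conj-≤-length p j = ListP.length-filter (j ℕ.≤?_) p

row-applyUpTo : ∀ {A : Set} (g : ℕ → List A) l {i} → i ℕ.< l → row (applyUpTo g l) (suc i) ≡ g i
row-applyUpTo g (suc l) {zero}  _       = ≡.refl
row-applyUpTo g (suc l) {suc i} (s≤s h) = row-applyUpTo (g ∘ suc) l h

row-beyond : ∀ {A : Set} (T : List (List A)) {i} → length T ℕ.≤ i → row T (suc i) ≡ []
row-beyond []      h                = ≡.refl
row-beyond (_ ∷ T) {suc i} (s≤s h) = row-beyond T h

row-zero : ∀ {A : Set} (T : List (List A)) → row T 0 ≡ []
row-zero []      = ≡.refl
row-zero (_ ∷ _) = ≡.refl

nth-applyUpTo : ∀ {A : Set} (d : A) (g : ℕ → A) l {k} → k ℕ.< l → nth d (applyUpTo g l) k ≡ g k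
nth-applyUpTo d g (suc l) {zero}  _       = ≡.refl
nth-applyUpTo d g (suc l) {suc k} (s≤s h) = nth-applyUpTo d (g ∘ suc) l h

rows-applyUpTo : ∀ {A : Set} (T : List (List A)) g → (∀ i → i ℕ.< length T → row T (suc i) ≡ g i) →
  T ≡ applyUpTo g (length T)
rows-applyUpTo []      g h = ≡.refl
rows-applyUpTo (r ∷ T) g h =
  ≡.cong₂ _∷_ (h 0 (s≤s z≤n)) (rows-applyUpTo T (g ∘ suc) (λ i p → h (suc i) (s≤s p)))

nths-applyUpTo : ∀ {A : Set} (d : A) xs g → (∀ k → k ℕ.< length xs → nth d xs k ≡ g k) →
  xs ≡ applyUpTo g (length xs)
nths-applyUpTo d []       g h = ≡.refl
nths-applyUpTo d (x ∷ xs) g h =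
  ≡.cong₂ _∷_ (h 0 (s≤s z≤n)) (nths-applyUpTo d xs (g ∘ suc) (λ k p → h (suc k) (s≤s p)))

module Rows (mu la : List ℕ) {A : Set} where

  rowOf : (ℕ → ℕ → A) → ℕ → List A
  rowOf f i = applyUpTo (λ k → f i (part mu (suc i) ℕ.+ k)) (part la (suc i) ∸ part mu (suc i))

  toRows : (ℕ → ℕ → A) → List (List A)
  toRows f = applyUpTo (rowOf f) (length la)

  InD-row : ∀ {i j} → InD mu la (suc i) (suc j) → i ℕ.< length la
  InD-row {i} {j} (_ , h) with i ℕ.<? length la
  ... | yes p = p
  ... | no ¬p = contradiction (ℕP.≤-trans h (ℕP.≤-reflexive (part-beyond la (ℕP.≮⇒≥ ¬p)))) (λ ())

  toRows-shape : ∀ f → HasShape mu la (toRows f)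
  toRows-shape f = ListP.length-applyUpTo (rowOf f) (length la) , rows
    where
    rows : ∀ i → length (row (toRows f) i) ≡ part la i ∸ part mu i
    rows zero = ≡.trans (≡.cong length (row-zero (toRows f)))
      (≡.sym (≡.trans (≡.cong (_∸ part mu 0) (part-zero la)) (ℕP.0∸n≡0 (part mu 0))))
    rows (suc i) with i ℕ.<? length la
    ... | yes p = ≡.trans (≡.cong length (row-applyUpTo (rowOf f) (length la) p)) (ListP.length-applyUpTo _ _)
    ... | no ¬p = ≡.trans
      (≡.cong length (row-beyond (toRows f)
        (ℕP.≤-trans (ℕP.≤-reflexive (ListP.length-applyUpTo (rowOf f) (length la))) (ℕP.≮⇒≥ ¬p))))
      (≡.sym (≡.trans (≡.cong (_∸ part mu (suc i)) (part-beyond la (ℕP.≮⇒≥ ¬p))) (ℕP.0∸n≡0 (part mu (suc i)))))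

  toRows-cell : ∀ d f {i j} → InD mu la (suc i) (suc j) → cell d mu (toRows f) (suc i) (suc j) ≡ f i j
  toRows-cell d f {i} {j} c@(s≤s mu≤j , j<la) = ≡.trans
    (≡.cong (λ r → nth d r (j ∸ part mu (suc i))) (row-applyUpTo (rowOf f) (length la) (InD-row c)))
    (≡.trans (nth-applyUpTo d _ _ (ℕP.∸-monoˡ-< j<la mu≤j)) (≡.cong (f i) (ℕP.m+[n∸m]≡n mu≤j)))

  toRows-cong : ∀ {f g} → (∀ i j → InD mu la (suc i) (suc j) → f i j ≡ g i j) → toRows f ≡ toRows g
  toRows-cong h = applyUpTo-cong (length la) (λ i _ → applyUpTo-cong _ (λ k k< → h i _
    (s≤s (ℕP.m≤m+n _ k) , ≡.subst (ℕ._≤ part la (suc i)) (≡.cong suc (ℕP.+-comm k _))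
      (ℕP.m≤o∸n⇒m+n≤o (suc k) (ℕP.<⇒≤ (ℕP.m∸n≢0⇒n<m (ℕP.m<n⇒n≢0 k<))) k<))))

  toRows-surjective : ∀ d {T} → HasShape mu la T → T ≡ toRows (λ i j → cell d mu T (suc i) (suc j))
  toRows-surjective d {T} (len , lens) = ≡.trans (rows-applyUpTo T (rowOf f) (λ i _ → row-eq i))
    (≡.cong (applyUpTo (rowOf f)) len)
    where
    f : ℕ → ℕ → A
    f i j = cell d mu T (suc i) (suc j)
    row-eq : ∀ i → row T (suc i) ≡ rowOf f i
    row-eq i = ≡.trans
      (nths-applyUpTo d (row T (suc i)) (λ k → f i (part mu (suc i) ℕ.+ k))
        (λ k _ → ≡.cong (nth d (row T (suc i))) (≡.sym (ℕP.m+n∸m≡n (part mu (suc i)) k))))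
      (≡.cong (applyUpTo _) (lens (suc i)))

-- Tableaux of the shape

extend : ∀ {n} → (Fin n → ℤ) → ℕ → ℤ
extend {zero}  f _       = + 0
extend {suc n} f zero    = f zero
extend {suc n} f (suc k) = extend (f ∘ suc) k

extend-toℕ : ∀ {n} (f : Fin n → ℤ) u → extend f (toℕ u) ≡ f u
extend-toℕ f zero    = ≡.refl
extend-toℕ f (suc u) = extend-toℕ (f ∘ suc) u

lower-bound : ∀ n (f : ℕ → ℤ) → ∃ λ l → ∀ k → k ℕ.< n → l ℤ.≤ f k
lower-bound zero    f = + 0 , λ _ ()
lower-bound (suc n) f with lower-bound n (f ∘ suc)
... | l , h = f 0 ℤ.⊓ l , λ { zero _ → ℤP.i⊓j≤i (f 0) l ; (suc k) (s≤s p) → ℤP.≤-trans (ℤP.i⊓j≤j (f 0) l) (h k p) }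

upper-bound : ∀ n (f : ℕ → ℤ) → ∃ λ l → ∀ k → k ℕ.< n → f k ℤ.≤ l
upper-bound zero    f = + 0 , λ _ ()
upper-bound (suc n) f with upper-bound n (f ∘ suc)
... | l , h = f 0 ℤ.⊔ l , λ { zero _ → ℤP.i≤i⊔j (f 0) l ; (suc k) (s≤s p) → ℤP.≤-trans (h k p) (ℤP.i≤j⊔i (f 0) l) }

record Window (n : ℕ) (a b : ℕ → ℤ) : Set where
  field
    lo    : ℤ
    size  : ℕ
    delay : ∀ j → j ℕ.< n → Σ[ d ∈ ℕ ] Σ[ N ∈ ℕ ] lo ℤ.+ + d ≡ a j × d ℕ.+ N ≡ size
    b<hi  : ∀ j → j ℕ.< n → b j ℤ.< lo ℤ.+ + size

window : ∀ n a b → Window n a b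
window n a b with lower-bound n a | upper-bound n a | upper-bound n b
-- The bound `u` on the lower flags is there because `a j > b j` is allowed, and `size` must still
-- split at `a j`.
... | l , l≤a | u , a≤u | v , b≤v with ≤⇒+ {l} {ℤ.suc (l ℤ.⊔ (u ℤ.⊔ v))} (ℤP.≤-trans (ℤP.i≤i⊔j l (u ℤ.⊔ v)) (ℤP.i≤suc[i] _))
... | N , hi≡ = record { lo = l ; size = N ; delay = delay ; b<hi = b<hi }
  where
  top : ℤ
  top = l ℤ.⊔ (u ℤ.⊔ v)
  b<hi : ∀ j → j ℕ.< n → b j ℤ.< l ℤ.+ + N
  b<hi j j<n = ≡.subst (b j ℤ.<_) hi≡ (ℤP.suc[i]≤j⇒i<j (ℤP.suc-mono
    (ℤP.≤-trans (b≤v j j<n) (ℤP.≤-trans (ℤP.i≤j⊔i u v) (ℤP.i≤j⊔i l (u ℤ.⊔ v))))))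
  delay : ∀ j → j ℕ.< n → Σ[ d ∈ ℕ ] Σ[ N′ ∈ ℕ ] l ℤ.+ + d ≡ a j × d ℕ.+ N′ ≡ N
  delay j j<n with ≤⇒+ (l≤a j j<n)
  ... | d , a≡ = d , N ∸ d , ≡.sym a≡ , ℕP.m+[n∸m]≡n d≤N
    where
    a≤hi : a j ℤ.≤ l ℤ.+ + N
    a≤hi = ≡.subst (a j ℤ.≤_) hi≡ (ℤP.≤-trans (ℤP.≤-trans (a≤u j j<n)
      (ℤP.≤-trans (ℤP.i≤i⊔j u v) (ℤP.i≤j⊔i l (u ℤ.⊔ v)))) (ℤP.i≤suc[i] top))
    d≤N : d ℕ.≤ N
    d≤N = ℤP.drop‿+≤+ (≤-linear (≡.subst (ℤ._≤ l ℤ.+ + N) a≡ a≤hi)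
      (solveℤ 3 (λ l d N → N ⊟ d ⊜ (l ⊹ N) ⊟ (l ⊹ d)) ≡.refl l (+ d) (+ N)))

strict⇒gap : ∀ (V : ℕ → ℤ) {s e} → (∀ i → s ℕ.≤ i → suc i ℕ.< e → V i ℤ.< V (suc i)) →
  ∀ d {i} → s ℕ.≤ i → i ℕ.+ d ℕ.< e → V i ℤ.+ + d ℤ.≤ V (i ℕ.+ d)
strict⇒gap V step zero {i} s≤i h =
  ℤP.≤-reflexive (≡.trans (ℤP.+-identityʳ (V i)) (≡.cong V (≡.sym (ℕP.+-identityʳ i))))
strict⇒gap V {s} {e} step (suc d) {i} s≤i h = ≡.subst (λ k → V i ℤ.+ + suc d ℤ.≤ V k) (≡.sym (ℕP.+-suc i d))
  (≤-linear₂ (strict⇒gap V step d s≤i (ℕP.<-trans ℕP.≤-refl h′))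
    (ℤP.i<j⇒suc[i]≤j (step (i ℕ.+ d) (ℕP.≤-trans s≤i (ℕP.m≤m+n i d)) h′))
    (solveℤ 4 (λ v d w x → x ⊟ (v ⊹ (K̂ (+ 1) ⊹ d)) ⊜ (w ⊟ (v ⊹ d)) ⊹ (x ⊟ (K̂ (+ 1) ⊹ w))) ≡.refl
      (V i) (+ d) (V (i ℕ.+ d)) (V (suc (i ℕ.+ d)))))
  where
  h′ : suc (i ℕ.+ d) ℕ.< e
  h′ = ≡.subst (ℕ._< e) (ℕP.+-suc i d) h

-- For integers, strict increase of V i amounts to weak increase of V i - i. Down a column of a
-- tableau this is the monotonicity of t - p.
strict⇒gap-between : ∀ (V : ℕ → ℤ) {s e} → (∀ i → s ℕ.≤ i → suc i ℕ.< e → V i ℤ.< V (suc i)) →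
  ∀ {i k} → s ℕ.≤ i → i ℕ.≤ k → k ℕ.< e → V i ℤ.- + i ℤ.≤ V k ℤ.- + k
strict⇒gap-between V step {i} {k} s≤i i≤k k<e with ℕP.m≤n⇒∃[o]m+o≡n i≤k
... | d , ≡.refl = ≤-linear (strict⇒gap V step d s≤i k<e)
  (solveℤ 4 (λ v w i d → w ⊟ (i ⊹ d) ⊟ (v ⊟ i) ⊜ w ⊟ (v ⊹ d)) ≡.refl (V i) (V (i ℕ.+ d)) (+ i) (+ d))

module Setting (la mu : List ℕ) (r : ℤ) (n : ℕ) (a b : Fin n → ℤ)
  (partition-la : IsPartition la) (partition-mu : IsPartition mu) (mu⊆la : Contained mu la)
  (la₁≤n : part la 1 ℕ.≤ n) (columnFlags : ColumnFlags mu la n a b) where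

  lam′ mu′ : ℕ → ℕ
  lam′ j = conj la (suc j)
  mu′  j = conj mu (suc j)

  lam′-decreasing : Decreasing lam′
  lam′-decreasing = conj-decreasing la partition-la

  mu′-decreasing : Decreasing mu′
  mu′-decreasing = conj-decreasing mu partition-mu

  mu′≤lam′ : ∀ j → mu′ j ℕ.≤ lam′ j
  mu′≤lam′ = conj-monotone mu la partition-mu partition-la mu⊆la

  κ : ℤ
  κ = r ℤ.- + 1 ℤ.+ + conj la 1

  content≡ : ∀ i j → content r la (suc i) (suc j) ≡ κ ℤ.- pos i j
  content≡ i j = solveℤ 4 (λ i j r c → (K̂ (+ 1) ⊹ j) ⊟ (K̂ (+ 1) ⊹ i) ⊹ r ⊟ K̂ (+ 1) ⊹ c
    ⊜ r ⊟ K̂ (+ 1) ⊹ c ⊟ (i ⊟ j)) ≡.refl (+ i) (+ j) r (+ conj la 1)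

  FlagsAt : ℕ → ℕ → Set
  FlagsAt s s′ = mu′ s ℕ.< lam′ s′ →
    (extend a s ℤ.- extend a s′ ℤ.≤ + mu′ s ℤ.- + mu′ s′ ℤ.+ + 1) ×
    (extend b s ℤ.- extend b s′ ℤ.≤ + lam′ s ℤ.- + lam′ s′ ℤ.+ + 1)

  flags : ∀ s → suc s ℕ.< n → FlagsAt s (suc s)
  flags s s<n = ≡.subst₂ FlagsAt i≡ k≡
    (flagsFin (fromℕ< (ℕP.<⇒≤ s<n)) (fromℕ< s<n) (≡.trans k≡ (≡.cong suc (≡.sym i≡))))
    where
    i≡ : toℕ (fromℕ< (ℕP.<⇒≤ s<n)) ≡ s
    i≡ = FinP.toℕ-fromℕ< _
    k≡ : toℕ (fromℕ< s<n) ≡ suc s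
    k≡ = FinP.toℕ-fromℕ< _
    flagsFin : ∀ (i k : Fin n) → toℕ k ≡ suc (toℕ i) → FlagsAt (toℕ i) (toℕ k)
    flagsFin i k adj rewrite extend-toℕ a i | extend-toℕ a k | extend-toℕ b i | extend-toℕ b k = columnFlags i k adj

  open Flags n lam′ mu′ (extend a) (extend b) lam′-decreasing mu′-decreasing flags public
  open Generation n lam′ κ Ok ok? public

  win : Window n (extend a) (extend b)
  win = window n (extend a) (extend b)
  open Window win public

  E : List (Event n)
  E = events lo size

  InD⇒Cell : ∀ {i j} → InD mu la (suc i) (suc j) → Cell mu′ i j
  InD⇒Cell {i} {j} (h , h′) =
    ℕP.≮⇒≥ (λ p → ℕP.<⇒≱ h (conj⇒part mu partition-mu i j p)) , part⇒conj la partition-la i j h′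

  Cell⇒InD : ∀ {i j} → Cell mu′ i j → InD mu la (suc i) (suc j)
  Cell⇒InD {i} {j} (h , h′) =
    ℕP.≰⇒> (λ p → ℕP.<⇒≱ (part⇒conj mu partition-mu i j p) h) , conj⇒part la partition-la i j h′

  InD⇒<n : ∀ {i j} → InD mu la (suc i) (suc j) → j ℕ.< n
  InD⇒<n {i} (_ , h) = ℕP.≤-trans h (ℕP.≤-trans (part-≤-part₁ la partition-la i) la₁≤n)

  -- Cells are indexed by naturals from 1, flags by `Fin n`. Row 0 and column 0 contain no cells,
  -- and `la₁≤n` puts the column of every cell within `Fin n`.
  InD-elim : ∀ (P : ℕ → ℕ → Set) → (∀ i (u : Fin n) → InD mu la (suc i) (col u) → P (suc i) (col u)) →
    ∀ i j → InD mu la i j → P i j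
  InD-elim P f zero    j       (h , h′) rewrite part-zero la = contradiction (ℕP.≤-trans h h′) (λ ())
  InD-elim P f (suc i) zero    (() , _)
  InD-elim P f (suc i) (suc j) c = ≡.subst (λ j → P (suc i) (suc j)) u≡
    (f i u (≡.subst (λ j → InD mu la (suc i) (suc j)) (≡.sym u≡) c))
    where
    u : Fin n
    u = fromℕ< (InD⇒<n c)
    u≡ : toℕ u ≡ j
    u≡ = FinP.toℕ-fromℕ< (InD⇒<n c)

  open Rows mu la

  fillingOf : List (List SEntry) → Filling
  fillingOf T i j = cellS mu T (suc i) (suc j)

  module _ {T} (inST : InST r mu la n a b T) where
    private
      Tt : List (List ℤ)
      Tt = proj₁ inST
      f : Filling
      f = fillingOf T

    val-cellZ : ∀ i u → Cell mu′ i (toℕ u) → val f i u ≡ cellZ mu Tt (suc i) (col u)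
    val-cellZ i u c with proj₂ (proj₂ (proj₂ inST)) (suc i) (col u) (Cell⇒InD c)
    ... | inj₁ e = ≡.cong (value i (toℕ u)) e
    ... | inj₂ e = ≡.trans (≡.cong (value i (toℕ u)) e)
      (≡.trans (≡.cong (λ c → cellZ mu Tt (suc i) (col u) ℤ.+ c ℤ.- (κ ℤ.- pos i (toℕ u))) (content≡ i (toℕ u)))
        (solveℤ 2 (λ t c → t ⊹ c ⊟ c ⊜ t) ≡.refl (cellZ mu Tt (suc i) (col u)) (κ ℤ.- pos i (toℕ u))))

    inST⇒tableau : IsTableau E mu′ f
    inST⇒tableau = tableau rows cols event fits
      where
      flagged : IsFlaggedZSSYT mu la n a b Tt
      flagged = proj₁ (proj₂ inST)
      rows : ∀ i u v → toℕ v ≡ suc (toℕ u) → Cell mu′ i (toℕ u) → Cell mu′ i (toℕ v) → val f i u ℤ.≤ val f i v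
      rows i u v adj cu cv rewrite val-cellZ i u cu | val-cellZ i v cv | adj =
        proj₁ (proj₂ flagged) (suc i) (col u) (Cell⇒InD cu) (Cell⇒InD cv)
      cols : ∀ i u → Cell mu′ i (toℕ u) → Cell mu′ (suc i) (toℕ u) → val f i u ℤ.< val f (suc i) u
      cols i u c c′ rewrite val-cellZ i u c | val-cellZ (suc i) u c′ =
        proj₁ (proj₂ (proj₂ flagged)) (suc i) (col u) (Cell⇒InD c) (Cell⇒InD c′)
      bounds : ∀ i u → Cell mu′ i (toℕ u) →
        extend a (toℕ u) ℤ.≤ val f i u × val f i u ℤ.≤ extend b (toℕ u)
      bounds i u c rewrite extend-toℕ a u | extend-toℕ b u | val-cellZ i u c =
        proj₂ (proj₂ (proj₂ flagged)) (suc i) u (Cell⇒InD c)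
      event : ∀ i u → Cell mu′ i (toℕ u) → (val f i u , u) ∈ E
      event i u c = ∈-events lo size u (ℤP.≤-trans lo≤a (proj₁ (bounds i u c)))
        (ℤP.≤-<-trans (proj₂ (bounds i u c)) (b<hi (toℕ u) (FinP.toℕ<n u)))
        where
        lo≤a : lo ℤ.≤ extend a (toℕ u)
        lo≤a with delay (toℕ u) (FinP.toℕ<n u)
        ... | d , _ , e , _ = ≡.subst (lo ℤ.≤_) e (ℤP.≤-trans (ℤP.≤-reflexive (≡.sym (ℤP.+-identityʳ lo)))
                (ℤP.+-monoʳ-≤ lo (+≤+ (z≤n {d}))))
      gap : ∀ {i k} u → mu′ (toℕ u) ℕ.≤ i → i ℕ.≤ k → k ℕ.< lam′ (toℕ u) →
        val f i u ℤ.- + i ℤ.≤ val f k u ℤ.- + k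
      gap u = strict⇒gap-between (λ i → val f i u) (λ i m≤i i< →
        cols i u (m≤i , ℕP.<⇒≤ i<) (ℕP.m≤n⇒m≤1+n m≤i , i<))
      fits : ∀ i u → Cell mu′ i (toℕ u) → Ok (val f i u) (pos i (toℕ u))
      fits i u c@(m≤i , i<l) = ok-inside {t = val f i u} (FinP.toℕ<n u) (FinP.toℕ<n u) (inj₁ ℕP.≤-refl)
        (≤-linear (+≤+ m≤i) (solveℤ 3 (λ i m j → i ⊟ j ⊟ (m ⊟ j) ⊜ i ⊟ m) ≡.refl (+ i) (+ mu′ j) (+ j)))
        (ℤP.suc[i]≤j⇒i<j (≤-linear (+≤+ i<l)
          (solveℤ 3 (λ i l j → l ⊟ j ⊟ (K̂ (+ 1) ⊹ (i ⊟ j)) ⊜ l ⊟ (K̂ (+ 1) ⊹ i)) ≡.refl (+ i) (+ lam′ j) (+ j))))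
        (≤-linear₂ (gap u ℕP.≤-refl m≤i i<l) (proj₁ (bounds (mu′ j) u (ℕP.≤-refl , ℕP.≤-<-trans m≤i i<l)))
          (solveℤ 6 (λ v i j w m a → v ⊟ (i ⊟ j) ⊟ (a ⊟ (m ⊟ j)) ⊜ (v ⊟ i ⊟ (w ⊟ m)) ⊹ (w ⊟ a)) ≡.refl
            (val f i u) (+ i) (+ j) (val f (mu′ j) u) (+ mu′ j) (extend a j)))
        -- `lam′ j` is passed as a variable, so that matching reveals its predecessor, the row of
        -- the last cell.
        (upper (lam′ j) ≡.refl i<l)
        where
        j : ℕ
        j = toℕ u
        upper : ∀ l → lam′ j ≡ l → i ℕ.< l → val f i u ℤ.- pos i j ℤ.≤ β j
        upper (suc l) l≡ (s≤s i≤l) = ≤-linear₂ (gap u m≤i i≤l l<) (proj₂ (bounds l u (ℕP.≤-trans m≤i i≤l , l<)))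
          (≡.trans (≡.cong (λ h → extend b j ℤ.- ℤ.pred (pos h j) ℤ.- (val f i u ℤ.- pos i j)) l≡)
            (solveℤ 6 (λ v i j w l b → b ⊟ (K̂ (ℤ.- + 1) ⊹ ((K̂ (+ 1) ⊹ l) ⊟ j)) ⊟ (v ⊟ (i ⊟ j))
              ⊜ (w ⊟ l ⊟ (v ⊟ i)) ⊹ (b ⊟ w)) ≡.refl (val f i u) (+ i) (+ j) (val f l u) (+ l) (extend b j)))
          where
          l< : l ℕ.< lam′ j
          l< = ≡.subst (l ℕ.<_) (≡.sym l≡) ℕP.≤-refl

  -- The integer filling is rebuilt from the values. `Ok` gives back the flags only at the first and
  -- the last cell of a column; strictness settles the cells in between.
  tableau⇒inST : ∀ {T} → HasShape mu la T → IsTableau E mu′ (fillingOf T) → InST r mu la n a b T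
  tableau⇒inST {T} shape s = Tt , (toRows-shape g , rows′ , cols′ , bounds) , shape , choice
    where
    open IsTableau s
    f : Filling
    f = fillingOf T
    g : ℕ → ℕ → ℤ
    g i j = value i j (f i j)
    Tt : List (List ℤ)
    Tt = toRows g
    Tt-cell : ∀ {i j} → InD mu la (suc i) (suc j) → cellZ mu Tt (suc i) (suc j) ≡ g i j
    Tt-cell = toRows-cell (+ 0) g
    rows′ : ∀ i j → InD mu la i j → InD mu la i (suc j) → cellZ mu Tt i j ℤ.≤ cellZ mu Tt i (suc j)
    rows′ = InD-elim (λ i j → InD mu la i (suc j) → cellZ mu Tt i j ℤ.≤ cellZ mu Tt i (suc j)) (λ i u c c′ →
      ≡.subst₂ ℤ._≤_ (≡.sym (Tt-cell c)) (≡.sym (Tt-cell c′)) (right i u c c′))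
      where
      right : ∀ i u → InD mu la (suc i) (col u) → InD mu la (suc i) (suc (col u)) → val f i u ℤ.≤ g i (col u)
      right i u c c′ = ≡.subst (λ j → val f i u ℤ.≤ g i j) v≡
        (rows i u v v≡ (InD⇒Cell c) (≡.subst (Cell mu′ i) (≡.sym v≡) (InD⇒Cell c′)))
        where
        v : Fin n
        v = fromℕ< (InD⇒<n c′)
        v≡ : toℕ v ≡ suc (toℕ u)
        v≡ = FinP.toℕ-fromℕ< (InD⇒<n c′)
    cols′ : ∀ i j → InD mu la i j → InD mu la (suc i) j → cellZ mu Tt i j ℤ.< cellZ mu Tt (suc i) j
    cols′ = InD-elim (λ i j → InD mu la (suc i) j → cellZ mu Tt i j ℤ.< cellZ mu Tt (suc i) j) (λ i u c c′ →
      ≡.subst₂ ℤ._<_ (≡.sym (Tt-cell c)) (≡.sym (Tt-cell c′)) (cols i u (InD⇒Cell c) (InD⇒Cell c′)))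
    weakly : ∀ {i k} u → mu′ (toℕ u) ℕ.≤ i → i ℕ.≤ k → k ℕ.< lam′ (toℕ u) → val f i u ℤ.≤ val f k u
    weakly {i} {k} u m≤i i≤k k<l with ℕP.m≤n⇒m<n∨m≡n i≤k
    ... | inj₁ i<k   = ℤP.<⇒≤ (cols-strict u m≤i i<k k<l)
    ... | inj₂ ≡.refl = ℤP.≤-refl
    bounds : ∀ i (u : Fin n) → InD mu la i (col u) → (a u ℤ.≤ cellZ mu Tt i (col u)) × (cellZ mu Tt i (col u) ℤ.≤ b u)
    bounds zero    u (h , h′) rewrite part-zero la = contradiction h′ (λ ())
    bounds (suc i) u c rewrite Tt-cell {i} {toℕ u} c | ≡.sym (extend-toℕ a u) | ≡.sym (extend-toℕ b u) =
      ℤP.≤-trans (okLower-start (FinP.toℕ<n u) (proj₁ (fits (mu′ j) u (ℕP.≤-refl , ℕP.≤-<-trans m≤i i<l))))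
        (weakly u ℕP.≤-refl m≤i i<l) ,
      upper (lam′ j) ≡.refl i<l
      where
      j : ℕ
      j = toℕ u
      m≤i : mu′ j ℕ.≤ i
      m≤i = proj₁ (InD⇒Cell c)
      i<l : i ℕ.< lam′ j
      i<l = proj₂ (InD⇒Cell c)
      upper : ∀ l → lam′ j ≡ l → i ℕ.< l → val f i u ℤ.≤ extend b j
      upper (suc l) l≡ (s≤s i≤l) = ℤP.≤-trans (weakly u m≤i i≤l l<)
        (≤-linear (okUpper-stop {val f l u} (FinP.toℕ<n u)
            (≡.trans (≡.sym (pos-suc l j)) (≡.cong (λ h → pos h j) (≡.sym l≡)))
            (proj₂ (fits l u (ℕP.≤-trans m≤i i≤l , l<))))
          (≡.trans (solveℤ 4 (λ b w l j → b ⊟ w ⊜ b ⊟ (K̂ (ℤ.- + 1) ⊹ ((K̂ (+ 1) ⊹ l) ⊟ j)) ⊟ (w ⊟ (l ⊟ j))) ≡.refl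
              (extend b j) (val f l u) (+ l) (+ j))
            (≡.cong (λ h → extend b j ℤ.- ℤ.pred (pos h j) ℤ.- (val f l u ℤ.- pos l j)) (≡.sym l≡))))
        where
        l< : l ℕ.< lam′ j
        l< = ≡.subst (l ℕ.<_) (≡.sym l≡) ℕP.≤-refl
    choice : ∀ i j → InD mu la i j →
      (cellS mu T i j ≡ unp (cellZ mu Tt i j)) ⊎ (cellS mu T i j ≡ pr (cellZ mu Tt i j ℤ.+ content r la i j))
    choice = InD-elim _ pick
      where
      pick : ∀ i u → InD mu la (suc i) (col u) →
        (cellS mu T (suc i) (col u) ≡ unp (cellZ mu Tt (suc i) (col u))) ⊎
        (cellS mu T (suc i) (col u) ≡ pr (cellZ mu Tt (suc i) (col u) ℤ.+ content r la (suc i) (col u)))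
      pick i u c rewrite Tt-cell {i} {toℕ u} c | content≡ i (toℕ u) = value-inverse i (toℕ u) (f i (toℕ u)) ≡.refl

  tableaux : List (List (List SEntry))
  tableaux = map toRows (gen E mu′)

  fillingOf-toRows : ∀ f → Agree mu′ (fillingOf (toRows f)) f
  fillingOf-toRows f i u c = toRows-cell (unp (+ 0)) f (Cell⇒InD c)

  tableau-cong : ∀ {f g} → Agree mu′ f g → IsTableau E mu′ f → IsTableau E mu′ g
  tableau-cong {f} {g} agree s = tableau
    (λ i u v adj c c′ → ≡.subst₂ ℤ._≤_ (eq c) (eq c′) (rows i u v adj c c′))
    (λ i u c c′ → ≡.subst₂ ℤ._<_ (eq c) (eq c′) (cols i u c c′))
    (λ i u c → ≡.subst (λ t → (t , u) ∈ E) (eq c) (event i u c))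
    (λ i u c → ≡.subst (λ t → Ok t (pos i (toℕ u))) (eq c) (fits i u c))
    where
    open IsTableau s
    eq : ∀ {i u} → Cell mu′ i (toℕ u) → val f i u ≡ val g i u
    eq {i} {u} c = ≡.cong (value i (toℕ u)) (agree i u c)

  tableaux-sound : ∀ {T} → T ∈ tableaux → InST r mu la n a b T
  tableaux-sound T∈ with ∈-map⁻ toRows T∈
  ... | f , f∈ , ≡.refl = tableau⇒inST {toRows f} (toRows-shape f)
    (tableau-cong {f} {fillingOf (toRows f)} (λ i u c → ≡.sym (fillingOf-toRows f i u c))
      (All.lookup (gen-sound E mu′ (events-sorted lo size)) f∈))

  tableaux-complete : ∀ {T} → InST r mu la n a b T → T ∈ tableaux
  tableaux-complete {T} inST = AnyP.map⁺ (Any.map (λ {f} → found {f})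
    (gen-complete lam′-decreasing E mu′ (events-sorted lo size) mu′≤lam′ (inST⇒tableau {T} inST)))
    where
    shape : HasShape mu la T
    shape = proj₁ (proj₂ (proj₂ inST))
    found : ∀ {f} → Agree mu′ (fillingOf T) f → T ≡ toRows f
    found {f} agree = ≡.trans (toRows-surjective (unp (+ 0)) {T} shape) (toRows-cong (λ i j c →
      ≡.subst (λ j → fillingOf T i j ≡ f i j) (FinP.toℕ-fromℕ< (InD⇒<n c))
        (agree i (fromℕ< (InD⇒<n c)) (≡.subst (Cell mu′ i) (≡.sym (FinP.toℕ-fromℕ< (InD⇒<n c))) (InD⇒Cell c)))))

  tableaux-unique : Unique tableaux
  tableaux-unique = AllPairsP.map⁺ (AllPairs.map (λ {f} {g} → distinct {f} {g}) (gen-apart E mu′ (events-sorted lo size)))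
    where
    distinct : ∀ {f g} → Apart mu′ f g → toRows f ≢ toRows g
    distinct {f} {g} (i , u , c , f≢g) eq = f≢g (≡.trans (≡.sym (fillingOf-toRows f i u c))
      (≡.trans (≡.cong (λ T → fillingOf T i (toℕ u)) eq) (fillingOf-toRows g i u c)))

-- The theorem

module Evaluation {c ℓ : Level} (R : CommutativeRing c ℓ) (y z : ℤ → CommutativeRing.Carrier R)
  (la mu : List ℕ) (r : ℤ) (n : ℕ) (a b : Fin n → ℤ)
  (partition-la : IsPartition la) (partition-mu : IsPartition mu) (mu⊆la : Contained mu la)
  (la₁≤n : part la 1 ℕ.≤ n) (columnFlags : ColumnFlags mu la n a b) where

  open CommutativeRing R hiding (zero; ring)
  open Alg R
  open Determinants R
  open Products R
  open SuperElementary R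
  open Setting la mu r n a b partition-la partition-mu mu⊆la la₁≤n columnFlags
  open Paths R y z κ Ok ok?
  open Entries R y z κ
  open NonIntersecting R y z n lam′ κ Ok ok? (length la) (λ k → conj-≤-length la (suc k)) lam′-decreasing
  open Rows mu la
  open Relation.Binary.Reasoning.Setoid setoid hiding (start; stop)

  sabEntry : Fin n → Fin n → Carrier
  sabEntry i j = eSuper (+ conj la (col i) ℤ.- + col i ℤ.- + conj mu (col j) ℤ.+ + col j)
    (seg y (a j) (b i)) (seg z (aConj r mu la a j) (bConj r la b i))

  entryAt : Fin n → Fin n → Carrier
  entryAt i j = Entry.entry y z κ (stop (toℕ i)) (extend b (toℕ i)) (extend a (toℕ j)) (start (toℕ j))

  sabEntry≡ : ∀ i j → sabEntry i j ≡ entryAt i j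
  sabEntry≡ i j rewrite extend-toℕ a j | extend-toℕ b i = ≡.cong₂ (λ d zs → eSuper d (seg y (a j) (b i)) zs)
    (solveℤ 4 (λ l i m j → l ⊟ (K̂ (+ 1) ⊹ i) ⊟ m ⊹ (K̂ (+ 1) ⊹ j) ⊜ (l ⊟ i) ⊟ (m ⊟ j)) ≡.refl
      (+ lam′ (toℕ i)) (+ toℕ i) (+ mu′ (toℕ j)) (+ toℕ j))
    (≡.cong₂ (seg z) (≡.cong (λ c → a j ℤ.+ c) (content≡ (mu′ (toℕ j)) (toℕ j)))
      (≡.cong (λ c → b i ℤ.+ c) (solveℤ 4 (λ l i r c → (K̂ (+ 1) ⊹ i) ⊟ l ⊹ r ⊟ K̂ (+ 1) ⊹ c
        ⊜ r ⊟ K̂ (+ 1) ⊹ c ⊟ (K̂ (ℤ.- + 1) ⊹ (l ⊟ i))) ≡.refl (+ lam′ (toℕ i)) (+ toℕ i) r (+ conj la 1))))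

  linked-entry : ∀ i j → Linked (toℕ i) (toℕ j) → sabEntry i j ≈ matrix E mu′ i j
  linked-entry i j linked with delay (toℕ j) (FinP.toℕ<n j)
  ... | d , N , a≡ , N≡ = begin
    sabEntry i j ≡⟨ sabEntry≡ i j ⟩
    entryAt i j  ≈⟨ path-from-start (FinP.toℕ<n i) (FinP.toℕ<n j) linked d N a≡
                      (≡.subst (λ N → extend b (toℕ i) ℤ.< lo ℤ.+ + N) (≡.sym N≡) (b<hi (toℕ i) (FinP.toℕ<n i))) ⟨
    path (interval lo (d ℕ.+ N)) (start (toℕ j)) (stop (toℕ i))
      ≡⟨ ≡.cong (λ ts → path ts (start (toℕ j)) (stop (toℕ i)))
           (≡.trans (≡.cong (interval lo) N≡) (≡.sym (times-events j lo size))) ⟩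
    matrix E mu′ i j ∎

  Cut : ℕ → ℕ → Set
  Cut i j = ∃ λ s → s ℕ.< j × (i ℕ.≤ s × lam′ (suc s) ℕ.≤ mu′ s)

  linked-or-cut : ∀ i j → Linked i j ⊎ Cut i j
  linked-or-cut i j with j ℕ.≤? i
  ... | yes j≤i = inj₁ (inj₁ j≤i)
  ... | no j≰i with ℕP.anyUpTo? (λ s → (i ℕ.≤? s) ×-dec (lam′ (suc s) ℕ.≤? mu′ s)) j
  ...   | yes cut = inj₂ cut
  ...   | no ¬cut = inj₁ (inj₂ (ℕP.≰⇒> j≰i , λ s i≤s s<j → ℕP.≰⇒> (λ l≤m → ¬cut (s , s<j , i≤s , l≤m))))

  cut-beyond : ∀ {s} → lam′ (suc s) ℕ.≤ mu′ s → ∀ {i j} → suc s ℕ.≤ i → j ℕ.< suc s → stop i ℤ.< start j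
  cut-beyond {s} l≤m {i} {j} s<i (s≤s j≤s) = pos-< (lam′ i) i (mu′ j) j (ℕP.+-mono-≤-<
    (ℕP.≤-trans (antitone lam′-decreasing s<i) (ℕP.≤-trans l≤m (antitone mu′-decreasing j≤s)))
    (ℕP.≤-<-trans j≤s s<i))

  -- No path leads from the columns up to `s` to the rows beyond `s`, so both matrices vanish there,
  -- and `(i , j)` lies above and to the right of this block. The column flags impose nothing across
  -- the cut, so equality of the two entries at `(i , j)` cannot be expected.
  cut-irrelevant : ∀ i j → Cut (toℕ i) (toℕ j) → Irrelevant sabEntry (matrix E mu′) i j
  cut-irrelevant i j (s , s<j , i≤s , l≤m) =
    suc s , below (suc s) , s≤s i≤s , ≮⇒below (suc s) j s<j ,
    count-below (suc s) n (ℕP.≤-trans s<j (ℕP.<⇒≤ (FinP.toℕ<n j))) ,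
    (λ i k s<i k∈ → trans (reflexive (sabEntry≡ i k))
      (Entry.entry-beyond y z κ (stop (toℕ i)) (extend b (toℕ i)) (extend a (toℕ k))
        (cut-beyond l≤m s<i (below⇒< (suc s) k k∈)))) ,
    (λ i k s<i k∈ → path-beyond (times k E) (cut-beyond l≤m s<i (below⇒< (suc s) k k∈)))

  Sab≈det : Sab y z r mu la n a b ≈ det n (matrix E mu′)
  Sab≈det = det-cong-relevant n compare
    where
    compare : ∀ i j → (sabEntry i j ≈ matrix E mu′ i j) ⊎ Irrelevant sabEntry (matrix E mu′) i j
    compare i j with linked-or-cut (toℕ i) (toℕ j)
    ... | inj₁ linked = inj₁ (linked-entry i j linked)
    ... | inj₂ cut    = inj₂ (cut-irrelevant i j cut)

  wtRow : List SEntry → Carrier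
  wtRow = foldr (λ e acc → wtE y z e * acc) 1#

  wtRow-++ : ∀ es es′ → wtRow (es ++ es′) ≈ wtRow es * wtRow es′
  wtRow-++ []       es′ = sym (*-identityˡ _)
  wtRow-++ (e ∷ es) es′ = trans (*-congˡ (wtRow-++ es es′)) (sym (*-assoc _ _ _))

  wtRow-applyUpTo : ∀ g k → wtRow (applyUpTo g k) ≈ prodN k (wtE y z ∘ g)
  wtRow-applyUpTo g zero    = refl
  wtRow-applyUpTo g (suc k) = *-congˡ (wtRow-applyUpTo (g ∘ suc) k)

  wt-applyUpTo : ∀ G k → wt y z (applyUpTo G k) ≈ prodN k (wtRow ∘ G)
  wt-applyUpTo G zero    = refl
  wt-applyUpTo G (suc k) = trans (wtRow-++ (G 0) _) (*-congˡ (wt-applyUpTo (G ∘ suc) k))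

  wt-toRows : ∀ f → wt y z (toRows f) ≈ fillingWt mu′ f
  wt-toRows f = trans (wt-applyUpTo (rowOf f) (length la)) (prodN-cong (length la) (λ i _ → row-weight i))
    where
    row-weight : ∀ i → wtRow (rowOf f i) ≈ prodN n (λ j → cellWt mu′ f i j)
    row-weight i = trans (wtRow-applyUpTo _ (part la (suc i) ∸ part mu (suc i)))
      (prodN-window (part mu (suc i)) (part la (suc i)) n {λ j → wtE y z (f i j)} (mu⊆la (suc i))
        (ℕP.≤-trans (part-≤-part₁ la partition-la i) la₁≤n)
        (λ j j<M → reflexive (cellWt-out mu′ f (λ c → ℕP.<⇒≱ (proj₁ (Cell⇒InD c)) j<M)))
        (λ j M≤j j<L → reflexive (cellWt-in mu′ f (InD⇒Cell (s≤s M≤j , j<L))))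
        (λ j L≤j → reflexive (cellWt-out mu′ f (λ c → ℕP.<⇒≱ (proj₂ (Cell⇒InD c)) L≤j))))

  sumWt-toRows : ∀ fs → sumWt y z (map toRows fs) ≈ total mu′ fs
  sumWt-toRows []       = refl
  sumWt-toRows (f ∷ fs) = +-cong (wt-toRows f) (sumWt-toRows fs)

  sumWt-↭ : ∀ {L L′} → L Perm.↭ L′ → sumWt y z L ≈ sumWt y z L′
  sumWt-↭ Perm.refl          = refl
  sumWt-↭ (Perm.prep T p)    = +-congˡ (sumWt-↭ p)
  sumWt-↭ (Perm.swap T T′ p) = begin
    _ ≈⟨ +-congˡ (+-congˡ (sumWt-↭ p)) ⟩
    _ ≈⟨ +-assoc _ _ _ ⟨
    _ ≈⟨ +-congʳ (+-comm _ _) ⟩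
    _ ≈⟨ +-assoc _ _ _ ⟩
    _ ∎
  sumWt-↭ (Perm.trans p q)   = trans (sumWt-↭ p) (sumWt-↭ q)

  Sab≈sumWt : ∀ L → Unique L → (∀ T → (T ∈ L → InST r mu la n a b T) × (InST r mu la n a b T → T ∈ L)) →
    Sab y z r mu la n a b ≈ sumWt y z L
  Sab≈sumWt L unique spec = begin
    Sab y z r mu la n a b   ≈⟨ Sab≈det ⟩
    det n (matrix E mu′)    ≈⟨ det≈total E mu′ (events-orderly lo size) mu′-decreasing mu′≤lam′ ⟩
    total mu′ (gen E mu′)   ≈⟨ sumWt-toRows (gen E mu′) ⟨
    -- `L` is an arbitrary enumeration without repetition of the same super tableaux, hence a
    -- permutation of `tableaux`.
    sumWt y z tableaux      ≈⟨ sumWt-↭ (∼bag⇒↭ (unique∧set⇒bag tableaux-unique unique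
                                 (λ {T} → mk⇔ (proj₂ (spec T) ∘ tableaux-sound) (tableaux-complete ∘ proj₁ (spec T))))) ⟩
    sumWt y z L             ∎

mainTheorem3 : {c ℓ : Level} (R : CommutativeRing c ℓ) (y z : ℤ → CommutativeRing.Carrier R)
    (la mu : List ℕ) (r : ℤ) (n : ℕ) (a b : Fin n → ℤ) →
    IsPartition la → IsPartition mu → Contained mu la →
    part la 1 ≤ n →
    ColumnFlags mu la n a b →
    (L : List (List (List SEntry))) → Unique L →
    (∀ T → (T ∈ L → InST r mu la n a b T) × (InST r mu la n a b T → T ∈ L)) →
    CommutativeRing._≈_ R (Alg.Sab R y z r mu la n a b) (Alg.sumWt R y z L)
mainTheorem3 R y z la mu r n a b pl pm sub la₁≤n flags =
  Evaluation.Sab≈sumWt R y z la mu r n a b pl pm sub la₁≤n flags
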